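{- Let $n\ge 1$. There are exactly $\binom{n}{3}+\binom{n-2}{3}$ butterflies in the Hasse diagram of $(\mathfrak{B}_n,\le)$. Furthermore, each Hasse edge $\pi\vartriangleleft\sigma$ is in either one or two butterflies. The edge $\pi\vartriangleleft\sigma$ is in a unique butterfly if and only if there is some coordinate $i\in\{1,2,3,4\}$ such that $\ell_i(\pi)=\ell_i(\sigma)=1$.
   Context: $\mathfrak{S}_n$ is the set of permutations of $[n]=\{1,\dots,n\}$, in one-line notation. A reduction of $\omega\in\mathfrak{S}_n$ interchanges $\omega(i)$ and $\omega(j)$ for some $i<j$ with $\omega(i)>\omega(j)$. Bruhat order: $\pi\le\sigma$ if $\pi$ is obtained from $\sigma$ by a (possibly empty) sequence of reductions. $\mathfrak{B}_n\subseteq\mathfrak{S}_n$ is the set of bigrassmannian permutations (both $\omega$ and $\omega^{ -1}$ have exactly one descent), with the order inherited from Bruhat order; equivalently $\omega=1\cdots a\,(b+1)\cdots c\,(a+1)\cdots b\,(c+1)\cdots n$ for a unique triple $0\le a<b<c\le n$. The length vector of such an element is $(\ell_1,\ell_2,\ell_3,\ell_4)=(a+1,b-a,c-b,n+1-c)$. $\pi\vartriangleleft\sigma$ means $\sigma$ covers $\pi$ in $\mathfrak{B}_n$ ($\pi<\sigma$ with no element of $\mathfrak{B}_n$ strictly between). The poset $(\mathfrak{B}_n,\le)$ is ranked with rank function $\lambda(\sigma)=\ell_2(\sigma)+\ell_3(\sigma)-2$. A butterfly is a set $\{\pi_1,\pi_2,\sigma_1,\sigma_2\}\subseteq\mathfrak{B}_n$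 of four distinct elements with $\pi_1,\pi_2$ of the same rank $k$, $\sigma_1,\sigma_2$ of rank $k+1$, and $\pi_i\vartriangleleft\sigma_j$ for all $i,j\in\{1,2\}$. An edge $\pi\vartriangleleft\sigma$ is in a butterfly if $\pi$ and $\sigma$ both belong to it. Convention: $\binom{m}{3}=0$ for integers $m<3$. -}

module Defs where

open import Level using (0ℓ)
open import Data.Nat using (ℕ; suc; _+_; _∸_; _<_; _≤_)
open import Data.Fin as Fin using (Fin; toℕ)
open import Data.Fin.Patterns using (1F; 2F)
open import Data.Fin.Permutation as Perm
  using (Permutation′; _⟨$⟩ʳ_; transpose; flip; _∘ₚ_)
open import Data.List as List using (List; []; _∷_; _++_)
import Data.List.Membership.Setoid as Membership
import Data.List.Relation.Binary.Subset.Setoid.Properties as Subset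
import Data.List.Relation.Unary.Unique.Setoid as Unique
open import Data.Product using (∃₂; ∃!; ∃-syntax; _×_; proj₁)
open import Data.Vec using (Vec; []; _∷_; lookup)
open import Function using (_∘_)
open import Function.Bundles using (Bijection)
open import Relation.Binary using (Rel; Setoid)
open import Relation.Binary.Construct.Closure.ReflexiveTransitive using (Star)
import Relation.Binary.Construct.NonStrictToStrict as ToStrict
import Relation.Binary.Construct.On as On
open import Relation.Binary.Properties.Preorder using (InducedEquivalence)
open import Relation.Binary.PropositionalEquality as ≡ using (_≡_)
open import Relation.Nullary using (¬_)

private
  variable
    n : ℕ

-- Positions and values of a permutation of [n] are elements of Fin n, so they
-- are shifted down by one.  Permutations are compared pointwise, since _≡_ on
-- Permutation′ n would also compare the proofs of invertibility.
permSetoid : ℕ → Setoid 0ℓ 0ℓ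
permSetoid n = record
  { Carrier       = Permutation′ n
  ; _≈_           = Perm._≈_
  ; isEquivalence = record
    { refl  = λ _ → ≡.refl
    ; sym   = λ p i → ≡.sym (p i)
    ; trans = λ p q i → ≡.trans (p i) (q i)
    }
  }

-- ω ⟶ ω′: the permutation ω′ is a reduction of ω.  In the diagrammatic
-- composition _∘ₚ_ the transposition acts first, i.e. on positions.
_⟶_ : Rel (Permutation′ n) 0ℓ
ω ⟶ ω′ = ∃₂ λ i j →
  i Fin.< j × (ω ⟨$⟩ʳ j) Fin.< (ω ⟨$⟩ʳ i) × ω′ Perm.≈ (transpose i j ∘ₚ ω)

-- Bruhat order.  The final _≈_ makes the empty sequence of reductions
-- relate pointwise equal permutations.
_≤ᴾ_ : Rel (Permutation′ n) 0ℓ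
π ≤ᴾ σ = ∃[ ρ ] (Star _⟶_ σ ρ × ρ Perm.≈ π)

Descent : Permutation′ n → Fin n → Set
Descent ω i = ∃[ j ] (toℕ j ≡ suc (toℕ i) × (ω ⟨$⟩ʳ j) Fin.< (ω ⟨$⟩ʳ i))

record Bigrassmannian (n : ℕ) : Set where
  field
    perm              : Permutation′ n
    oneDescent        : ∃! _≡_ (Descent perm)
    oneInverseDescent : ∃! _≡_ (Descent (flip perm))

open Bigrassmannian public

bigrassmannianSetoid : ℕ → Setoid 0ℓ 0ℓ
bigrassmannianSetoid n = On.setoid (permSetoid n) perm

module _ {n : ℕ} where

  open Setoid (bigrassmannianSetoid n) public
    using () renaming (_≈_ to _≈ᴮ_)

  _≤ᴮ_ : Rel (Bigrassmannian n) 0ℓ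
  π ≤ᴮ σ = perm π ≤ᴾ perm σ

  open ToStrict _≈ᴮ_ _≤ᴮ_ public
    using () renaming (_<_ to _<ᴮ_)

  infix 4 _⋖_
  _⋖_ : Rel (Bigrassmannian n) 0ℓ
  π ⋖ σ = π <ᴮ σ × ¬ (∃[ τ ] (π <ᴮ τ × τ <ᴮ σ))

-- One-line notation, with values in {1, …, n}.
oneLine : Permutation′ n → List ℕ
oneLine ω = List.tabulate (suc ∘ toℕ ∘ (ω ⟨$⟩ʳ_))

-- The list (a+1) ⋯ b.
interval : ℕ → ℕ → List ℕ
interval a b = List.applyUpTo (λ k → suc (a + k)) (b ∸ a)

-- The length vector is given as a functional relation: every bigrassmannian
-- permutation arises from exactly one triple a < b < c ≤ n.
HasLengths : Bigrassmannian n → Vec ℕ 4 → Set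
HasLengths {n} ω ℓ = ∃[ a ] ∃[ b ] ∃[ c ]
  ( a < b × b < c × c ≤ n
  × oneLine (perm ω) ≡ interval 0 a ++ interval b c ++ interval a b ++ interval c n
  × ℓ ≡ suc a ∷ b ∸ a ∷ c ∸ b ∷ suc n ∸ c ∷ [] )

-- ℓᵢ(ω) = m, where i = 0, 1, 2, 3 stands for the coordinates 1, 2, 3, 4.
HasLength : Bigrassmannian n → Fin 4 → ℕ → Set
HasLength ω i m = ∃[ ℓ ] (HasLengths ω ℓ × lookup ℓ i ≡ m)

-- λ(ω) = k.  No truncation occurs in the subtraction, as ℓ₂, ℓ₃ ≥ 1.
HasRank : Bigrassmannian n → ℕ → Set
HasRank ω k = ∃[ ℓ ] (HasLengths ω ℓ × lookup ℓ 1F + lookup ℓ 2F ∸ 2 ≡ k)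

record Butterfly (n : ℕ) : Set where
  field
    π₁ π₂ σ₁ σ₂ : Bigrassmannian n

  elements : List (Bigrassmannian n)
  elements = π₁ ∷ π₂ ∷ σ₁ ∷ σ₂ ∷ []

  field
    distinct : Unique.Unique (bigrassmannianSetoid n) elements
    k        : ℕ
    rank-π₁  : HasRank π₁ k
    rank-π₂  : HasRank π₂ k
    rank-σ₁  : HasRank σ₁ (suc k)
    rank-σ₂  : HasRank σ₂ (suc k)
    π₁⋖σ₁    : π₁ ⋖ σ₁
    π₁⋖σ₂    : π₁ ⋖ σ₂
    π₂⋖σ₁    : π₂ ⋖ σ₁
    π₂⋖σ₂    : π₂ ⋖ σ₂

-- Two butterflies are equal when their lists of elements are contained in each
-- other, i.e. when they are equal as sets.
butterflySetoid : ℕ → Setoid 0ℓ 0ℓ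
butterflySetoid n = On.setoid
  (InducedEquivalence (Subset.⊆-preorder (bigrassmannianSetoid n)))
  Butterfly.elements

_∈ᵇ_ : Bigrassmannian n → Butterfly n → Set
_∈ᵇ_ {n} τ X = τ ∈ Butterfly.elements X
  where open Membership (bigrassmannianSetoid n) using (_∈_)

butterfliesContaining : (π σ : Bigrassmannian n) → Setoid 0ℓ 0ℓ
butterfliesContaining {n} π σ =
  On.setoid (butterflySetoid n) (proj₁ {B = λ X → π ∈ᵇ X × σ ∈ᵇ X})

HasCardinality : Setoid 0ℓ 0ℓ → ℕ → Set
HasCardinality S N = Bijection (≡.setoid (Fin N)) S

{-# OPTIONS --safe #-}

-- Subtracting 1 from every ℓᵢ identifies 𝔅ₙ with the vectors v ∈ ℕ⁴ of sum n − 2.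
-- Four statistics are monotone in the Bruhat order: the length of the fixed
-- prefix, that of the fixed suffix, and the largest amounts by which an entry
-- exceeds, or falls short of, its position.  On 𝔅ₙ they are given by ℓ₁, ℓ₄, ℓ₂
-- and ℓ₃, so π ≤ σ forces ℓ₁ and ℓ₄ to decrease weakly and ℓ₂ and ℓ₃ to increase
-- weakly.  Conversely, moving a unit from ℓ₁ or ℓ₄ to ℓ₂ or ℓ₃ is undone by
-- reductions, so these moves are exactly the covers, and a cover has the form
-- v + eᵢ ⋖ v + eⱼ with i ∈ {1, 4}, j ∈ {2, 3}.  A butterfly is then either
-- {v + e_c | c} for some v of sum n − 3, or {v + 1 − e_c | c} (where 1 is the
-- all-ones vector) for some v of sum n − 5; this gives C(n, 3) + C(n − 2, 3).
-- An edge lies in exactly one butterfly of the first kind, and in one of the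
-- second kind unless some coordinate vanishes at both of its ends.
module Submission where

open import Defs
open import Data.Nat
open import Data.Nat.Properties
open import Data.Nat.Combinatorics using (_C_; nCk+nC[k+1]≡[n+1]C[k+1]; nCk≡nC[n∸k]; nCn≡1; k>n⇒nCk≡0)
open import Data.Nat.Tactic.RingSolver using (solve-∀)
open import Data.Empty using (⊥-elim)
open import Data.Fin as Fin using (Fin; toℕ; fromℕ<)
open import Data.Fin.Patterns using (0F; 1F; 2F; 3F)
open import Data.Fin.Permutation as Perm using
  (Permutation′; permutation; _⟨$⟩ʳ_; _⟨$⟩ˡ_; flip; inverseˡ; inverseʳ; transpose; _∘ₚ_)
open import Data.Fin.Properties as Fin using
  (toℕ<n; toℕ-fromℕ<; toℕ-injective; fromℕ<-toℕ; fromℕ<-cong; +↔⊎)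
open import Data.List as List using (List; []; _∷_; _++_; _∷ʳ_; [_]; applyUpTo)
open import Data.List.Membership.Propositional using (_∈_)
open import Data.List.Membership.Propositional.Properties using (∈-map⁻)
open import Data.List.Properties using
  (map-++; map-applyUpTo; ∷-injective; tabulate-cong; ++-assoc; applyUpTo-∷ʳ)
open import Data.List.Relation.Binary.Permutation.Propositional using
  (_↭_; prep; swap; ↭-refl; ↭-trans; ↭-sym)
open import Data.List.Relation.Binary.Permutation.Propositional.Properties using (∈-resp-↭)
open import Data.List.Relation.Unary.All using (All; []; _∷_)
open import Data.List.Relation.Unary.All.Properties using (applyUpTo⁺₁)
open import Data.List.Relation.Unary.AllPairs using ([]; _∷_)
open import Data.List.Relation.Unary.Any as Any using (here; there)
import Data.List.Relation.Unary.Any.Properties as Any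
open import Data.Product hiding (swap)
open import Data.Sum using (_⊎_; inj₁; inj₂; [_,_]′)
open import Data.Sum.Function.Propositional using (_⊎-↔_)
open import Data.Vec as Vec using (Vec; []; _∷_; lookup; updateAt)
open import Data.Vec.Properties using (≡-dec; lookup∘updateAt; lookup∘updateAt′; lookup-map)
open import Function using (_∘_; id)
open import Function.Bundles using (Bijection; Injection; Inverse; _↔_; _⇔_; mk↔ₛ′; mk⇔)
open import Function.Construct.Composition using (_↔-∘_; _⇔-∘_)
open import Function.Construct.Identity using (↔-id)
open import Function.Properties.Inverse using (↔⇒↣)
open import Level using (0ℓ)
open import Relation.Binary using (Rel; Setoid)
open import Relation.Binary.Construct.Closure.ReflexiveTransitive using (Star; ε; _◅_; _◅◅_; gmap)
open import Relation.Binary.Definitions using (tri<; tri≈; tri>)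
open import Relation.Binary.PropositionalEquality hiding ([_])
open import Relation.Nullary

-- As `Bigrassmannian` is defined through descents, the identification with vectors itself needs
-- proof. A permutation and its inverse are extended by the identity to mutually inverse maps of ℕ,
-- each strictly increasing across every pair of neighbours but one. If `a` is the first point that
-- is moved, the images of `a` under the two maps exceed `a` by the lengths of the two exchanged
-- blocks, and monotonicity leaves no choice for any other entry. The binomials arise because C(s +
-- 3, 3) vectors in ℕ⁴ have sum s. The conditions on sums are kept in additive form, so that for
-- small n they have no solution and agree with the convention for binomial coefficients.

private
  variable
    n : ℕ

-- The block exchange underlying the permutation with given a, b, c

-- The second function is reindexed to start at 0, so nested uses mirror the concatenation of lists;
-- `applyUpTo-glue` relies on this.
glue : ∀ {A : Set} → ℕ → (ℕ → A) → (ℕ → A) → ℕ → A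
glue zero    f g x       = g x
glue (suc l) f g zero    = f zero
glue (suc l) f g (suc x) = glue l (f ∘ suc) g x

glue-< : ∀ {A : Set} {l x} (f g : ℕ → A) → x < l → glue l f g x ≡ f x
glue-< {l = suc l} {zero}  f g _         = refl
glue-< {l = suc l} {suc x} f g (s≤s x<l) = glue-< (f ∘ suc) g x<l

glue-+ : ∀ {A : Set} l x (f g : ℕ → A) → glue l f g (l + x) ≡ g x
glue-+ zero    x f g = refl
glue-+ (suc l) x f g = glue-+ l x (f ∘ suc) g

applyUpTo-glue : ∀ {A : Set} l r (f g : ℕ → A) →
  applyUpTo (glue l f g) (l + r) ≡ applyUpTo f l ++ applyUpTo g r
applyUpTo-glue zero    r f g = refl
applyUpTo-glue (suc l) r f g = cong (f 0 ∷_) (applyUpTo-glue l r (f ∘ suc) g)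

<-or-+ : ∀ l x → x < l ⊎ ∃[ t ] x ≡ l + t
<-or-+ zero    x       = inj₂ (x , refl)
<-or-+ (suc l) zero    = inj₁ z<s
<-or-+ (suc l) (suc x) with <-or-+ l x
... | inj₁ x<l      = inj₁ (s<s x<l)
... | inj₂ (t , eq) = inj₂ (t , cong suc eq)

-- Zero-based one-line notation of 1 ⋯ a (b+1) ⋯ c (a+1) ⋯ b (c+1) ⋯, where p = b − a
-- and q = c − b.  The four blocks of positions are called A, C, B, D.
blockSwap : (a p q : ℕ) → ℕ → ℕ
blockSwap a p q =
  glue a id (glue q (λ t → a + (p + t)) (glue p (a +_) (λ t → a + (p + (q + t)))))

-- Positions are written as offsets into their block, so matching on a `Region` brings the argument
-- into the form of the equations `blockSwap-A` to `blockSwap-D`.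
data Region (a p q : ℕ) : ℕ → Set where
  inA : ∀ {x} → x < a → Region a p q x
  inC : ∀ {t} → t < q → Region a p q (a + t)
  inB : ∀ {t} → t < p → Region a p q (a + (q + t))
  inD : ∀ t → Region a p q (a + (q + (p + t)))

region : ∀ a p q x → Region a p q x
region a p q x with <-or-+ a x
... | inj₁ x<a = inA x<a
... | inj₂ (y , refl) with <-or-+ q y
...   | inj₁ y<q = inC y<q
...   | inj₂ (z , refl) with <-or-+ p z
...     | inj₁ z<p = inB z<p
...     | inj₂ (t , refl) = inD t

module _ (a p q : ℕ) where

  blockSwap-A : ∀ {x} → x < a → blockSwap a p q x ≡ x
  blockSwap-A = glue-< _ _

  blockSwap-C : ∀ {t} → t < q → blockSwap a p q (a + t) ≡ a + (p + t)
  blockSwap-C t<q = trans (glue-+ a _ _ _) (glue-< _ _ t<q)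

  blockSwap-B : ∀ {t} → t < p → blockSwap a p q (a + (q + t)) ≡ a + t
  blockSwap-B t<p = trans (glue-+ a _ _ _) (trans (glue-+ q _ _ _) (glue-< _ _ t<p))

  blockSwap-D : ∀ t → blockSwap a p q (a + (q + (p + t))) ≡ a + (p + (q + t))
  blockSwap-D t = trans (glue-+ a _ _ _) (trans (glue-+ q _ _ _) (glue-+ p _ _ _))

  blockSwap-fix : ∀ {x} → a + (p + q) ≤ x → blockSwap a p q x ≡ x
  blockSwap-fix {x} c≤x with t , refl ← m≤n⇒∃[o]m+o≡n c≤x = begin
    blockSwap a p q (a + (p + q) + t)   ≡⟨ cong (blockSwap a p q) eq ⟩
    blockSwap a p q (a + (q + (p + t))) ≡⟨ blockSwap-D t ⟩
    a + (p + (q + t))                   ≡⟨ cong (a +_) (+-assoc p q t) ⟨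
    a + (p + q + t)                     ≡⟨ +-assoc a (p + q) t ⟨
    a + (p + q) + t                     ∎
    where
    open ≡-Reasoning
    eq : a + (p + q) + t ≡ a + (q + (p + t))
    eq = trans (+-assoc a _ t) (cong (a +_) (trans (cong (_+ t) (+-comm p q)) (+-assoc q p t)))

-- Exchanging `p` and `q` exchanges the roles of C and B, so each block lands in the region where
-- the other map undoes the shift.
blockSwap-inverse : ∀ a p q x → blockSwap a q p (blockSwap a p q x) ≡ x
blockSwap-inverse a p q x with region a p q x
... | inA x<a rewrite blockSwap-A a p q x<a = blockSwap-A a q p x<a
... | inC t<q rewrite blockSwap-C a p q t<q = blockSwap-B a q p t<q
... | inB t<p rewrite blockSwap-B a p q t<p = blockSwap-C a q p t<p
... | inD t   rewrite blockSwap-D a p q t   = blockSwap-D a q p t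

module _ (a p q : ℕ) where

  blockSwap-≥ : ∀ {x} → a ≤ x → a ≤ blockSwap a p q x
  blockSwap-≥ {x} a≤x with region a p q x
  ... | inA x<a = contradiction a≤x (<⇒≱ x<a)
  ... | inC t<q rewrite blockSwap-C a p q t<q = m≤m+n a _
  ... | inB t<p rewrite blockSwap-B a p q t<p = m≤m+n a _
  ... | inD t   rewrite blockSwap-D a p q t   = m≤m+n a _

  blockSwap-<n : ∀ {x n} → a + (p + q) ≤ n → x < n → blockSwap a p q x < n
  blockSwap-<n {x} {n} c≤n x<n with region a p q x
  ... | inA x<a rewrite blockSwap-A a p q x<a = x<n
  ... | inC t<q rewrite blockSwap-C a p q t<q =
    <-≤-trans (+-monoʳ-< a (+-monoʳ-< p t<q)) c≤n
  ... | inB t<p rewrite blockSwap-B a p q t<p =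
    <-≤-trans (+-monoʳ-< a (<-≤-trans t<p (m≤m+n p q))) c≤n
  ... | inD t   rewrite blockSwap-D a p q t =
    subst (_< n) (cong (a +_) (trans (sym (+-assoc q p t)) (trans (cong (_+ t) (+-comm q p))
      (+-assoc p q t)))) x<n

  -- Only block C is raised, and by exactly `p`.
  blockSwap-≤+ : ∀ x → blockSwap a p q x ≤ x + p
  blockSwap-≤+ x with region a p q x
  ... | inA x<a rewrite blockSwap-A a p q x<a = m≤m+n x p
  ... | inC {t} t<q rewrite blockSwap-C a p q t<q =
    ≤-reflexive (trans (cong (a +_) (+-comm p t)) (sym (+-assoc a t p)))
  ... | inB {t} t<p rewrite blockSwap-B a p q t<p =
    ≤-trans (+-monoʳ-≤ a (m≤n+m t q)) (m≤m+n _ p)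
  ... | inD t rewrite blockSwap-D a p q t =
    ≤-trans (≤-reflexive
      (cong (a +_) (trans (sym (+-assoc p q t)) (trans (cong (_+ t) (+-comm p q)) (+-assoc q p t)))))
        (m≤m+n _ p)

≤blockSwap+ : ∀ a p q x → x ≤ blockSwap a p q x + q
≤blockSwap+ a p q x = subst (_≤ blockSwap a p q x + q) (blockSwap-inverse a p q x)
  (blockSwap-≤+ a q p (blockSwap a p q x))

module _ (a m k : ℕ) where

  private
    f : ℕ → ℕ
    f = blockSwap a (suc m) (suc k)

  blockSwap-descent : f (suc (a + k)) < f (a + k)
  blockSwap-descent = subst₂ _<_
    (sym (trans (cong f eq) (blockSwap-B a (suc m) (suc k) z<s)))
    (sym (blockSwap-C a (suc m) (suc k) (n<1+n k)))
    (+-monoʳ-< a z<s)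
    where
    eq : suc (a + k) ≡ a + (suc k + 0)
    eq = trans (sym (+-suc a k)) (cong (a +_) (sym (+-identityʳ (suc k))))

  private
    noDescent : ∀ {x y u v} → suc x ≡ y → f x ≡ u → f y ≡ v → u ≤ v → ¬ f (suc x) < f x
    noDescent refl refl refl u≤v dec = <⇒≱ dec u≤v

  -- Within a block the values grow by one, and the borders from A to C and from B to D are ascents;
  -- only the border from C to B remains.
  blockSwap-uniqueDescent : ∀ {x} → f (suc x) < f x → x ≡ a + k
  blockSwap-uniqueDescent {x} dec with region a (suc m) (suc k) x
  ... | inA x<a with m≤n⇒m<n∨m≡n x<a
  ...   | inj₁ 1+x<a = contradiction dec
    (noDescent refl (blockSwap-A a (suc m) (suc k) x<a) (blockSwap-A a (suc m) (suc k) 1+x<a) (n≤1+n x))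
  ...   | inj₂ refl  = contradiction dec
    (noDescent refl (blockSwap-A a (suc m) (suc k) x<a) refl
      (≤-trans (n≤1+n x) (blockSwap-≥ a (suc m) (suc k) ≤-refl)))
  blockSwap-uniqueDescent dec | inC {t} (s≤s t≤k) with m≤n⇒m<n∨m≡n t≤k
  ... | inj₂ refl = refl
  ... | inj₁ t<k = contradiction dec
    (noDescent (sym (+-suc a t)) (blockSwap-C a (suc m) (suc k) (s≤s t≤k)) (blockSwap-C a (suc m) (suc k)
      (s<s t<k))
      (+-monoʳ-≤ a (+-monoʳ-≤ (suc m) (n≤1+n t))))
  blockSwap-uniqueDescent dec | inB {t} (s≤s t≤m) with m≤n⇒m<n∨m≡n t≤m
  ... | inj₁ t<m = contradiction dec
    (noDescent (trans (sym (+-suc a _)) (cong (a +_) (sym (+-suc (suc k) t))))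
      (blockSwap-B a (suc m) (suc k) (s≤s t≤m)) (blockSwap-B a (suc m) (suc k) (s<s t<m))
        (+-monoʳ-≤ a (n≤1+n t)))
  ... | inj₂ refl = contradiction dec
    (noDescent eq (blockSwap-B a (suc m) (suc k) (s≤s t≤m)) (blockSwap-D a (suc m) (suc k) 0)
      (+-monoʳ-≤ a (≤-trans (n≤1+n m) (m≤m+n (suc m) _))))
    where
    eq : suc (a + (suc k + m)) ≡ a + (suc k + (suc m + 0))
    eq = trans (sym (+-suc a _)) (cong (a +_)
      (trans (sym (+-suc (suc k) m)) (cong (suc k +_) (sym (+-identityʳ (suc m))))))
  blockSwap-uniqueDescent dec | inD t = contradiction dec
    (noDescent eq (blockSwap-D a (suc m) (suc k) t) (blockSwap-D a (suc m) (suc k) (suc t))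
      (+-monoʳ-≤ a (+-monoʳ-≤ (suc m) (+-monoʳ-≤ (suc k) (n≤1+n t)))))
    where
    eq : suc (a + (suc k + (suc m + t))) ≡ a + (suc k + (suc m + suc t))
    eq = trans (sym (+-suc a _)) (cong (a +_)
      (trans (sym (+-suc (suc k) _)) (cong (suc k +_) (sym (+-suc (suc m) t)))))

-- Bijections of ℕ with a single descent in both directions

-- A descent at `p` is allowed but not asserted; its existence is stated separately where it is
-- used.
OnlyDescent : (ℕ → ℕ) → ℕ → Set
OnlyDescent f p = ∀ {x} → f (suc x) < f x → x ≡ p

module OnlyDescents {f g : ℕ → ℕ} (gf : ∀ x → g (f x) ≡ x) (fg : ∀ x → f (g x) ≡ x)
  {p q : ℕ} (f-desc : OnlyDescent f p) (g-desc : OnlyDescent g q) where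

  -- Injectivity excludes equal neighbouring values, so the absence of a descent is already a strict
  -- ascent.
  ascent : ∀ {x} → x ≢ p → f x < f (suc x)
  ascent {x} x≢p with <-cmp (f x) (f (suc x))
  ... | tri< lt _ _ = lt
  ... | tri≈ _ eq _ = contradiction
    (trans (sym (gf x)) (trans (cong g eq) (gf (suc x)))) (<⇒≢ (n<1+n x))
  ... | tri> _ _ gt = contradiction (f-desc gt) x≢p

  increasing : ∀ {x y} → p < x → x < y → f x < f y
  increasing {x} {y} p<x x<y with m≤n⇒∃[o]m+o≡n x<y
  ... | o , refl = go o
    where
    go : ∀ o → f x < f (suc x + o)
    go zero    rewrite +-identityʳ x = ascent (>⇒≢ p<x)
    go (suc o) rewrite +-suc x o =
      <-trans (go o) (ascent (>⇒≢ (<-≤-trans p<x (≤-trans (m≤m+n x o) (n≤1+n _)))))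

module FirstNonFixed {f g : ℕ → ℕ} (gf : ∀ x → g (f x) ≡ x) (fg : ∀ x → f (g x) ≡ x)
  {a : ℕ} (fix : ∀ {x} → x < a → f x ≡ x) where

  g-fix : ∀ {x} → x < a → g x ≡ x
  g-fix {x} x<a = trans (cong g (sym (fix x<a))) (gf x)

  above : ∀ {x} → a ≤ x → a ≤ f x
  above {x} a≤x with a ≤? f x
  ... | yes a≤fx = a≤fx
  ... | no  a≰fx = contradiction a≤x (<⇒≱ (subst (_< a) eq (≰⇒> a≰fx)))
    where
    eq : f x ≡ x
    eq = trans (sym (g-fix (≰⇒> a≰fx))) (gf x)

module Blocks {f g : ℕ → ℕ} (gf : ∀ x → g (f x) ≡ x) (fg : ∀ x → f (g x) ≡ x)
  {p q : ℕ} (f-desc : OnlyDescent f p) (g-desc : OnlyDescent g q)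
  {a m k : ℕ} (fix : ∀ {x} → x < a → f x ≡ x) (fa : f a ≡ a + suc m) (ga : g a ≡ a + suc k)
  where

  private
    module F = OnlyDescents gf fg f-desc g-desc
    module G = OnlyDescents fg gf g-desc f-desc
    module Ff = FirstNonFixed {f} {g} gf fg {a} fix

  -- The value `a` sits at position `a + suc k`. The entry just before it is at least `a` and
  -- different from `a`, hence larger.
  f-descentAt : a + k ≡ p
  f-descentAt = f-desc (subst (_< f (a + k)) (sym eq)
    (≤∧≢⇒< (Ff.above (m≤m+n a k)) a≢))
    where
    eq : f (suc (a + k)) ≡ a
    eq = trans (cong f (trans (sym (+-suc a k)) (sym ga))) (fg a)
    a≢ : a ≢ f (a + k)
    a≢ e = <⇒≢ (+-monoʳ-< a (n<1+n k)) (trans (sym (gf (a + k))) (trans (cong g (sym e)) ga))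

  -- This equation is `f-descentAt` for the inverse map. As a parameter, it lets the instances of
  -- `Blocks` for `f` and for `g` supply each other.
  module _ (g-descentAt : a + m ≡ q) where

    q<b+ : ∀ t → q < a + (suc m + t)
    q<b+ t = subst (_< a + (suc m + t)) g-descentAt (+-monoʳ-< a (m≤m+n (suc m) t))

    -- An entry skipped between positions x and x + 1 would have to sit after
    -- x + 1, against the monotonicity of g beyond its descent.
    f-blockC : ∀ {t} → t < suc k → f (a + t) ≡ a + (suc m + t)
    f-blockC {zero}  _ rewrite +-identityʳ a | +-identityʳ m = fa
    f-blockC {suc t} (s≤s t<k) = ≤-antisym upper lower
      where
      x y : ℕ
      x = a + t
      y = a + (suc m + t)
      y+1 : suc y ≡ a + (suc m + suc t)
      y+1 = trans (sym (+-suc a _)) (cong (a +_) (sym (+-suc (suc m) t)))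
      fx : f x ≡ y
      fx = f-blockC {t} (<-trans t<k (n<1+n k))
      gy : g y ≡ x
      gy = trans (cong g (sym fx)) (gf x)
      lower : a + (suc m + suc t) ≤ f (a + suc t)
      lower = subst₂ _≤_ y+1 (cong f (sym (+-suc a t)))
        (subst (_< f (suc x)) fx
          (F.ascent (<⇒≢ (subst (x <_) f-descentAt (+-monoʳ-< a t<k)))))
      x<gy+1 : x < g (a + (suc m + suc t))
      x<gy+1 = subst₂ _<_ gy (cong g y+1) (G.ascent (>⇒≢ (q<b+ t)))
      upper : f (a + suc t) ≤ a + (suc m + suc t)
      upper = ≮⇒≥ λ lt → <⇒≱ (subst (g (a + (suc m + suc t)) <_) (gf _)
                                (G.increasing (q<b+ (suc t)) lt))
                          (subst (_≤ g (a + (suc m + suc t))) (sym (+-suc a t)) x<gy+1)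

module Tail {f g : ℕ → ℕ} (gf : ∀ x → g (f x) ≡ x) (fg : ∀ x → f (g x) ≡ x)
  {p q : ℕ} (f-desc : OnlyDescent f p) (g-desc : OnlyDescent g q)
  {c : ℕ} (p<c : p < c) (c≤ : c ≤ f c) where

  -- Beyond its descent the map gains at least one per step, so once on or above the diagonal it
  -- stays there.
  expanding : ∀ t → c + t ≤ f (c + t)
  expanding zero    = subst (λ x → x ≤ f x) (sym (+-identityʳ c)) c≤
  expanding (suc t) rewrite +-suc c t =
    ≤-trans (s≤s (expanding t)) (OnlyDescents.ascent gf fg f-desc g-desc (>⇒≢ (<-≤-trans p<c (m≤m+n c t))))

  expands : ∀ {x} → c ≤ x → x ≤ f x
  expands c≤x with t , refl ← m≤n⇒∃[o]m+o≡n c≤x = expanding t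

leastNonFixed : ∀ (f : ℕ → ℕ) N → (∀ x → x < N → f x ≡ x) ⊎ ∃[ a ] (f a ≢ a × (∀ x → x < a → f x ≡ x))
leastNonFixed f zero = inj₁ λ _ ()
leastNonFixed f (suc N) with leastNonFixed f N
... | inj₂ found = inj₂ found
... | inj₁ fix with f N ≟ N
...   | no fN≢N  = inj₂ (N , fN≢N , fix)
...   | yes fN≡N = inj₁ fix′
  where
  fix′ : ∀ x → x < suc N → f x ≡ x
  fix′ x x<1+N with m≤n⇒m<n∨m≡n (s≤s⁻¹ x<1+N)
  ... | inj₁ x<N  = fix x x<N
  ... | inj₂ refl = fN≡N

module BlockSwap {f g : ℕ → ℕ} (gf : ∀ x → g (f x) ≡ x) (fg : ∀ x → f (g x) ≡ x)
  {p q : ℕ} (f-desc : OnlyDescent f p) (g-desc : OnlyDescent g q)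
  {a m k : ℕ} (fix : ∀ {x} → x < a → f x ≡ x) (fa : f a ≡ a + suc m) (ga : g a ≡ a + suc k)
  where

  private
    module Ff = FirstNonFixed {f} {g} gf fg {a} fix
    module BF = Blocks gf fg f-desc g-desc {a} {m} {k} fix fa ga
    module BG = Blocks fg gf g-desc f-desc {a} {k} {m} Ff.g-fix ga fa
    f-C : ∀ {t} → t < suc k → f (a + t) ≡ a + (suc m + t)
    f-C = BF.f-blockC BG.f-descentAt
    g-C : ∀ {t} → t < suc m → g (a + t) ≡ a + (suc k + t)
    g-C = BG.f-blockC BF.f-descentAt
    f-B : ∀ {t} → t < suc m → f (a + (suc k + t)) ≡ a + t
    f-B t<m = trans (cong f (sym (g-C t<m))) (fg _)
    g-B : ∀ {t} → t < suc k → g (a + (suc m + t)) ≡ a + t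
    g-B t<k = trans (cong g (sym (f-C t<k))) (gf _)
    c : ℕ
    c = a + (suc k + suc m)
    c′ : c ≡ a + (suc m + suc k)
    c′ = cong (a +_) (+-comm (suc k) (suc m))
    -- With c the end of the blocks, a value `f c` below c would lie in a block that `g` sends below
    -- c, against `g (f c) ≡ c`. The statement is generic in the pair of maps so as to serve both
    -- directions.
    outside : ∀ {f g : ℕ → ℕ} {m k} → (∀ x → g (f x) ≡ x) →
      (∀ {x} → x < a → g x ≡ x) →
      (∀ {t} → t < suc m → g (a + t) ≡ a + (suc k + t)) →
      (∀ {t} → t < suc k → g (a + (suc m + t)) ≡ a + t) →
      a + (suc m + suc k) ≤ f (a + (suc m + suc k))
    outside {f} {g} {m} {k} gf g-fix g-C g-B = ≮⇒≥ λ lt →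
      <⇒≢ (absurd lt (region a (suc k) (suc m) _)) (gf (a + (suc m + suc k)))
      where
      absurd : ∀ {y} → y < a + (suc m + suc k) → Region a (suc k) (suc m) y → g y < a + (suc m + suc k)
      absurd lt (inA y<a) = subst (_< a + (suc m + suc k)) (sym (g-fix y<a)) lt
      absurd lt (inC {t} t<m) = subst (_< a + (suc m + suc k)) (sym (g-C t<m))
        (+-monoʳ-< a (subst (suc k + t <_) (+-comm (suc k) (suc m)) (+-monoʳ-< (suc k) t<m)))
      absurd lt (inB t<k) = subst (_< a + (suc m + suc k)) (sym (g-B t<k))
        (+-monoʳ-< a (<-≤-trans t<k (m≤n+m (suc k) (suc m))))
      absurd lt (inD t) = contradiction (+-cancelˡ-< a _ _ lt) (≤⇒≯ (+-monoʳ-≤ (suc m) (m≤m+n (suc k) t)))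
    p<c : p < c
    p<c = subst (_< c) BF.f-descentAt (+-monoʳ-< a (m≤m+n (suc k) (suc m)))
    q<c : q < c
    q<c = subst (_< c) BG.f-descentAt (+-monoʳ-< a (m≤n+m (suc m) (suc k)))
    module TF = Tail gf fg f-desc g-desc p<c
      (subst (λ c → c ≤ f c) (sym c′) (outside {f} {g} {m} {k} gf Ff.g-fix g-C g-B))
    module TG = Tail fg gf g-desc f-desc q<c
      (outside {g} {f} {k} {m} fg fix f-C f-B)
    -- From `c` on, both of two mutually inverse maps are expanding, which leaves only the identity.
    f-D : ∀ {x} → c ≤ x → f x ≡ x
    f-D {x} c≤x = ≤-antisym (subst (f x ≤_) (gf x) (TG.expands (≤-trans c≤x (TF.expands c≤x))))
      (TF.expands c≤x)

  same : ∀ x → f x ≡ blockSwap a (suc m) (suc k) x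
  same x with region a (suc m) (suc k) x
  ... | inA x<a = trans (fix x<a) (sym (blockSwap-A a (suc m) (suc k) x<a))
  ... | inC t<k = trans (f-C t<k) (sym (blockSwap-C a (suc m) (suc k) t<k))
  ... | inB t<m = trans (f-B t<m) (sym (blockSwap-B a (suc m) (suc k) t<m))
  ... | inD t   = trans (f-D c≤)
      (sym (blockSwap-fix a (suc m) (suc k) (subst (_≤ a + (suc k + (suc m + t))) c′ c≤)))
    where
    c≤ : c ≤ a + (suc k + (suc m + t))
    c≤ = +-monoʳ-≤ a (+-monoʳ-≤ (suc k) (m≤m+n (suc m) t))

onlyDescents⇒blockSwap : ∀ {f g : ℕ → ℕ} → (∀ x → g (f x) ≡ x) → (∀ x → f (g x) ≡ x) →
  ∀ {p q} → f (suc p) < f p → OnlyDescent f p → OnlyDescent g q →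
  ∃[ a ] ∃[ m ] ∃[ k ] (∀ x → f x ≡ blockSwap a (suc m) (suc k) x)
-- The bound `2 + p` covers positions `p` and `suc p`: if both were fixed, there would be no descent
-- at `p`.
onlyDescents⇒blockSwap {f} {g} gf fg {p} descent f-desc g-desc with leastNonFixed f (2 + p)
... | inj₁ fix = contradiction descent
  (<⇒≯ (subst₂ _<_ (sym (fix p (m≤n⇒m≤1+n (n<1+n p)))) (sym (fix (suc p) (n<1+n (suc p)))) (n<1+n p)))
... | inj₂ (a , fa≢a , fix) =
  let m , fa = gap (above {f} {g} gf fg (fix _) ≤-refl) fa≢a
      k , ga = gap (above {g} {f} fg gf (g-fix {f} {g} gf fg (fix _)) ≤-refl) λ e →
        fa≢a (trans (cong f (sym e)) (fg a))
  in a , m , k , BlockSwap.same gf fg f-desc g-desc (fix _) fa ga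
  where
  open FirstNonFixed
  gap : ∀ {a b} → a ≤ b → b ≢ a → ∃[ o ] b ≡ a + suc o
  gap a≤b b≢a with m≤n⇒∃[o]m+o≡n a≤b
  ... | zero  , eq = contradiction (trans (sym eq) (+-identityʳ _)) b≢a
  ... | suc o , eq = o , sym eq

-- Length vectors of bigrassmannian permutations

-- Extension by the identity creates no descent, as all values stay below n.
extend : Permutation′ n → ℕ → ℕ
extend {n} ω x with x <? n
... | yes x<n = toℕ (ω ⟨$⟩ʳ fromℕ< x<n)
... | no  _   = x

extend-< : ∀ (ω : Permutation′ n) {x} (x<n : x < n) → extend ω x ≡ toℕ (ω ⟨$⟩ʳ fromℕ< x<n)
extend-< {n} ω {x} x<n with x <? n
... | yes _  = cong (toℕ ∘ (ω ⟨$⟩ʳ_)) (fromℕ<-cong x x refl _ _)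
... | no x≮n = contradiction x<n x≮n

extend-≥ : ∀ (ω : Permutation′ n) {x} → n ≤ x → extend ω x ≡ x
extend-≥ {n} ω {x} n≤x with x <? n
... | yes x<n = contradiction x<n (≤⇒≯ n≤x)
... | no _    = refl

extend-toℕ : ∀ (ω : Permutation′ n) i → extend ω (toℕ i) ≡ toℕ (ω ⟨$⟩ʳ i)
extend-toℕ ω i = trans (extend-< ω (toℕ<n i)) (cong (toℕ ∘ (ω ⟨$⟩ʳ_)) (fromℕ<-toℕ i (toℕ<n i)))

extend-inverse : ∀ (ω π : Permutation′ n) → (∀ i → π ⟨$⟩ʳ (ω ⟨$⟩ʳ i) ≡ i) → ∀ x → extend π (extend ω x) ≡ x
extend-inverse {n} ω π πω x with x <? n
... | yes x<n = trans (extend-toℕ π _) (trans (cong toℕ (πω _)) (toℕ-fromℕ< x<n))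
... | no x≮n  = extend-≥ π (≮⇒≥ x≮n)

extend-onlyDescent : ∀ (ω : Permutation′ n) {i} → (∀ {j} → Descent ω j → i ≡ j) →
  OnlyDescent (extend ω) (toℕ i)
extend-onlyDescent {n} ω {i} unique {x} dec with suc x <? n
... | yes 1+x<n = sym
    (trans (cong toℕ (unique (fromℕ< 1+x<n , trans (toℕ-fromℕ< 1+x<n) (cong suc (sym (toℕ-fromℕ< x<n))) ,
      dec′))) (toℕ-fromℕ< x<n))
  where
  x<n : x < n
  x<n = <-trans (n<1+n x) 1+x<n
  dec′ : (ω ⟨$⟩ʳ fromℕ< 1+x<n) Fin.< (ω ⟨$⟩ʳ fromℕ< x<n)
  dec′ = subst (toℕ (ω ⟨$⟩ʳ fromℕ< 1+x<n) <_) (extend-< ω x<n) dec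
... | no 1+x≮n with x <? n
...   | yes x<n = contradiction dec (<⇒≯ (<-≤-trans (toℕ<n _) (≮⇒≥ 1+x≮n)))
...   | no _    = contradiction dec (<⇒≯ (n<1+n x))

extend-descent : ∀ (ω : Permutation′ n) {i} → Descent ω i → extend ω (suc (toℕ i)) < extend ω (toℕ i)
extend-descent ω {i} (j , eq , dec) = subst₂ _<_
  (trans (sym (extend-toℕ ω j)) (cong (extend ω) eq)) (sym (extend-toℕ ω i)) dec

-- One-line notation of a shape.

run : ℕ → ℕ → List ℕ
run s l = applyUpTo (λ t → suc (s + t)) l

-- The vector of the ℓᵢ − 1.
Lengths : Set
Lengths = Vec ℕ 4

shape : Lengths → ℕ → ℕ
shape (a ∷ m ∷ k ∷ d ∷ []) = blockSwap a (suc m) (suc k)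

line : Lengths → List ℕ
line (a ∷ m ∷ k ∷ d ∷ []) =
  run 0 a ++ run (a + suc m) (suc k) ++ run a (suc m) ++ run (a + suc m + suc k) d

applyUpTo-cong : ∀ {f g : ℕ → ℕ} → (∀ x → f x ≡ g x) → ∀ n → applyUpTo f n ≡ applyUpTo g n
applyUpTo-cong eq zero    = refl
applyUpTo-cong eq (suc n) = cong₂ _∷_ (eq 0) (applyUpTo-cong (eq ∘ suc) n)

applyUpTo-shape : ∀ a m k d →
  applyUpTo (suc ∘ shape (a ∷ m ∷ k ∷ d ∷ [])) (a + (suc k + (suc m + d))) ≡ line (a ∷ m ∷ k ∷ d ∷ [])
applyUpTo-shape a m k d = begin
  applyUpTo (suc ∘ blockSwap a p q) (a + (q + (p + d)))
    ≡⟨ map-applyUpTo (blockSwap a p q) suc _ ⟨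
  List.map suc (applyUpTo (blockSwap a p q) (a + (q + (p + d))))
    ≡⟨ cong (List.map suc) (trans (applyUpTo-glue a _ id (glue q fC (glue p (a +_) fD)))
      (cong (applyUpTo id a ++_)
         (trans (applyUpTo-glue q _ fC (glue p (a +_) fD))
           (cong (applyUpTo fC q ++_) (applyUpTo-glue p d (a +_) fD))))) ⟩
  List.map suc (applyUpTo id a ++ applyUpTo fC q ++ applyUpTo (a +_) p ++ applyUpTo fD d)
    ≡⟨ trans (map-++ suc (applyUpTo id a) _) (cong₂ _++_ (map-applyUpTo id suc a)
       (trans (map-++ suc (applyUpTo fC q) _) (cong₂ _++_ (map-applyUpTo fC suc q)
       (trans (map-++ suc (applyUpTo (a +_) p) _) (cong₂ _++_ (map-applyUpTo (a +_) suc p)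
         (map-applyUpTo fD suc d)))))) ⟩
  run 0 a ++ applyUpTo (suc ∘ fC) q ++ run a p ++ applyUpTo (suc ∘ fD) d
    ≡⟨ cong (run 0 a ++_) (cong₂ _++_ (applyUpTo-cong (λ t → cong suc (sym (+-assoc a p t))) q)
       (cong (run a p ++_) (applyUpTo-cong (λ t → cong suc (trans (cong (a +_) (sym (+-assoc p q t)))
         (trans (sym (+-assoc a (p + q) t)) (cong (_+ t) (sym (+-assoc a p q)))))) d))) ⟩
  line (a ∷ m ∷ k ∷ d ∷ []) ∎
  where
  open ≡-Reasoning
  p q : ℕ
  p = suc m
  q = suc k
  fC fD : ℕ → ℕ
  fC t = a + (p + t)
  fD t = a + (p + (q + t))

size : Lengths → ℕ
size v = Vec.sum v + 2

size≡ : ∀ a m k d → a + (m + (k + (d + 0))) + 2 ≡ a + (suc k + (suc m + d))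
size≡ = solve-∀

size≡′ : ∀ a m k d → a + (m + (k + (d + 0))) + 2 ≡ a + (suc m + suc k) + d
size≡′ = solve-∀

tabulate-applyUpTo : ∀ n (f : ℕ → ℕ) → List.tabulate {n = n} (f ∘ toℕ) ≡ applyUpTo f n
tabulate-applyUpTo zero    f = refl
tabulate-applyUpTo (suc n) f = cong (f 0 ∷_) (tabulate-applyUpTo n (f ∘ suc))

tabulate-injective : ∀ {f g : Fin n → ℕ} → List.tabulate f ≡ List.tabulate g → ∀ i → f i ≡ g i
tabulate-injective eq Fin.zero    = proj₁ (∷-injective eq)
tabulate-injective eq (Fin.suc i) = tabulate-injective (proj₂ (∷-injective eq)) i

line≡tabulate : ∀ v → size v ≡ n → line v ≡ List.tabulate {n = n} (suc ∘ shape v ∘ toℕ)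
line≡tabulate v@(a ∷ m ∷ k ∷ d ∷ []) refl = trans (sym (applyUpTo-shape a m k d))
  (trans (cong (applyUpTo (suc ∘ shape v)) (sym (size≡ a m k d)))
    (sym (tabulate-applyUpTo (size v) (suc ∘ shape v))))

infix 4 _HasShape_

_HasShape_ : Permutation′ n → Lengths → Set
ω HasShape v = ∀ i → toℕ (ω ⟨$⟩ʳ i) ≡ shape v (toℕ i)

module _ (ω : Permutation′ n) (v : Lengths) (|v|≡n : size v ≡ n) where

  shape⇒line : ω HasShape v → oneLine ω ≡ line v
  shape⇒line sh = trans (tabulate-cong (λ i → cong suc (sh i))) (sym (line≡tabulate v |v|≡n))

  line⇒shape : oneLine ω ≡ line v → ω HasShape v
  line⇒shape eq i = suc-injective (tabulate-injective (trans eq (line≡tabulate v |v|≡n)) i)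

classify : (ω : Bigrassmannian n) → ∃[ v ] (size v ≡ n × perm ω HasShape v)
classify {n} ω = (a ∷ m ∷ k ∷ n ∸ c ∷ []) , trans (size≡′ a m k (n ∸ c)) (m+[n∸m]≡n c≤n) ,
  λ i → trans (sym (extend-toℕ π i)) (same (toℕ i))
  where
  π : Permutation′ n
  π = perm ω
  found : ∃[ a ] ∃[ m ] ∃[ k ] (∀ x → extend π x ≡ blockSwap a (suc m) (suc k) x)
  found with i , desc , unique ← oneDescent ω | j , _ , unique′ ← oneInverseDescent ω =
    onlyDescents⇒blockSwap
      (extend-inverse π (flip π) (λ i → inverseˡ π))
      (extend-inverse (flip π) π (λ i → inverseʳ π))
      (extend-descent π desc) (extend-onlyDescent π unique) (extend-onlyDescent (flip π) unique′)
  a m k c : ℕ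
  a = proj₁ found
  m = proj₁ (proj₂ found)
  k = proj₁ (proj₂ (proj₂ found))
  same : ∀ x → extend π x ≡ blockSwap a (suc m) (suc k) x
  same = proj₂ (proj₂ (proj₂ found))
  c = a + (suc m + suc k)
  last : c ≡ suc (a + (suc k + m))
  last = trans (cong (a +_) (trans (+-suc (suc m) k) (cong suc (+-comm (suc m) k))))
    (trans (cong (λ x → a + suc x) (+-suc k m)) (+-suc a _))
  -- If the blocks reached past `n`, the last position of block B would be fixed by `extend`,
  -- whereas `blockSwap` lowers it by `suc k`.
  c≤n : c ≤ n
  c≤n = ≮⇒≥ λ n<c →
    <⇒≢ (+-monoʳ-< a (s≤s (m≤n+m m k)))
      (trans (sym (blockSwap-B a (suc m) (suc k) (n<1+n m)))
        (trans (sym (same _)) (extend-≥ π (s≤s⁻¹ (subst (n <_) last n<c)))))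

module _ (a m k d : ℕ) where

  private
    N : ℕ
    N = size (a ∷ m ∷ k ∷ d ∷ [])

  blockSwap-<size : ∀ {x} → x < N → blockSwap a (suc m) (suc k) x < N
  blockSwap-<size = blockSwap-<n a (suc m) (suc k)
    (subst (a + (suc m + suc k) ≤_) (sym (size≡′ a m k d)) (m≤m+n _ d))

-- Realisation of every length vector by a permutation.

private
  size-comm : ∀ a m k d → a + (m + (k + (d + 0))) + 2 ≡ a + (k + (m + (d + 0))) + 2
  size-comm = solve-∀

onlyDescent : (ω : Permutation′ n) (v : Lengths) → size v ≡ n → ω HasShape v → ∃! _≡_ (Descent ω)
onlyDescent ω v@(a ∷ m ∷ k ∷ d ∷ []) refl sh =
  i , (j , eq , dec) , λ (j , eq , dec) → toℕ-injective (trans (toℕ-fromℕ< i<n) (sym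
    (blockSwap-uniqueDescent a m k
      (subst₂ _<_ (trans (sh j) (cong (shape v) eq)) (sh _) dec))))
  where
  j<n : suc (a + k) < size v
  j<n = subst (suc (suc (a + k)) ≤_) (sym (lemma a m k d)) (m≤m+n _ (m + d))
    where
    lemma : ∀ a m k d → a + (m + (k + (d + 0))) + 2 ≡ suc (suc (a + k)) + (m + d)
    lemma = solve-∀
  i<n : a + k < size v
  i<n = <-trans (n<1+n _) j<n
  i j : Fin (size v)
  i = fromℕ< i<n
  j = fromℕ< j<n
  eq : toℕ j ≡ suc (toℕ i)
  eq = trans (toℕ-fromℕ< j<n) (cong suc (sym (toℕ-fromℕ< i<n)))
  dec : (ω ⟨$⟩ʳ j) Fin.< (ω ⟨$⟩ʳ i)
  dec = subst₂ _<_
    (sym (trans (sh j) (cong (shape v) (toℕ-fromℕ< j<n))))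
    (sym (trans (sh i) (cong (shape v) (toℕ-fromℕ< i<n))))
    (blockSwap-descent a m k)

-- The vector of the inverse permutation: inversion exchanges the lengths of the two moved blocks.
flipLengths : Lengths → Lengths
flipLengths (a ∷ m ∷ k ∷ d ∷ []) = a ∷ k ∷ m ∷ d ∷ []

size-flipLengths : ∀ v → size (flipLengths v) ≡ size v
size-flipLengths (a ∷ m ∷ k ∷ d ∷ []) = size-comm a k m d

shape-flipLengths : ∀ v x → shape (flipLengths v) (shape v x) ≡ x
shape-flipLengths (a ∷ m ∷ k ∷ d ∷ []) x = blockSwap-inverse a (suc m) (suc k) x

flipLengths-involutive : ∀ v → flipLengths (flipLengths v) ≡ v
flipLengths-involutive (a ∷ m ∷ k ∷ d ∷ []) = refl

shape-<size : ∀ v {x} → x < size v → shape v x < size v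
shape-<size (a ∷ m ∷ k ∷ d ∷ []) = blockSwap-<size a m k d

shapeFin : (v : Lengths) → size v ≡ n → Fin n → Fin n
shapeFin v refl i = fromℕ< (shape-<size v (toℕ<n i))

toℕ-shapeFin : ∀ v (|v|≡n : size v ≡ n) i → toℕ (shapeFin v |v|≡n i) ≡ shape v (toℕ i)
toℕ-shapeFin v refl i = toℕ-fromℕ< _

shapePerm : (v : Lengths) → size v ≡ n → Permutation′ n
shapePerm {n} v |v|≡n = permutation f g
  (λ i → toℕ-injective (begin
    toℕ (f (g i))                        ≡⟨ toℕ-shapeFin v |v|≡n _ ⟩
    shape v (toℕ (g i))                  ≡⟨ cong (shape v) (toℕ-shapeFin v′ |v′|≡n i) ⟩
    shape v (shape v′ (toℕ i)) ≡⟨ cong (λ u → shape u (shape v′ (toℕ i))) (flipLengths-involutive v) ⟨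
    shape (flipLengths v′) (shape v′ (toℕ i)) ≡⟨ shape-flipLengths v′ (toℕ i) ⟩
    toℕ i                                ∎))
  (λ i → toℕ-injective (begin
    toℕ (g (f i))               ≡⟨ toℕ-shapeFin v′ |v′|≡n _ ⟩
    shape v′ (toℕ (f i))        ≡⟨ cong (shape v′) (toℕ-shapeFin v |v|≡n i) ⟩
    shape v′ (shape v (toℕ i))  ≡⟨ shape-flipLengths v (toℕ i) ⟩
    toℕ i                       ∎))
  where
  open ≡-Reasoning
  v′ : Lengths
  v′ = flipLengths v
  |v′|≡n : size v′ ≡ n
  |v′|≡n = trans (size-flipLengths v) |v|≡n
  f g : Fin n → Fin n
  f = shapeFin v |v|≡n
  g = shapeFin v′ |v′|≡n

opaque
  fromLengths : (v : Lengths) → size v ≡ n → Bigrassmannian n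
  fromLengths v |v|≡n = record
    { perm = shapePerm v |v|≡n
    ; oneDescent = onlyDescent (shapePerm v |v|≡n) v |v|≡n (toℕ-shapeFin v |v|≡n)
    ; oneInverseDescent = onlyDescent (flip (shapePerm v |v|≡n)) (flipLengths v)
      (trans (size-flipLengths v) |v|≡n)
        (toℕ-shapeFin (flipLengths v) (trans (size-flipLengths v) |v|≡n))
    }

  shape-fromLengths : ∀ (v : Lengths) (|v|≡n : size v ≡ n) → perm (fromLengths v |v|≡n) HasShape v
  shape-fromLengths v |v|≡n = toℕ-shapeFin v |v|≡n

-- Bruhat-monotone statistics

transpose-cases : ∀ (i j x : Fin n) (let y = transpose i j ⟨$⟩ʳ x) →
  (x ≡ i × y ≡ j) ⊎ (x ≡ j × y ≡ i) ⊎ y ≡ x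
transpose-cases i j x with x Fin.≟ i
... | yes x≡i = inj₁ (x≡i , refl)
... | no _ with x Fin.≟ j
...   | yes x≡j = inj₂ (inj₁ (x≡j , refl))
...   | no _    = inj₂ (inj₂ refl)

perm-injective : ∀ (ω : Permutation′ n) {x y} → ω ⟨$⟩ʳ x ≡ ω ⟨$⟩ʳ y → x ≡ y
perm-injective ω eq = trans (sym (inverseˡ ω)) (trans (cong (ω ⟨$⟩ˡ_) eq) (inverseˡ ω))

-- Induction along the chain. Invariance under pointwise equality is assumed because each reduction,
-- and the end of the chain, is given only up to `Perm._≈_`.
≤ᴾ-preserves : (P : Permutation′ n → Set) →
  (∀ ω ω′ → ω Perm.≈ ω′ → P ω → P ω′) →
  (∀ ω {i j} → i Fin.< j → (ω ⟨$⟩ʳ j) Fin.< (ω ⟨$⟩ʳ i) → P ω → P (transpose i j ∘ₚ ω)) →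
  ∀ {π σ} → π ≤ᴾ σ → P σ → P π
≤ᴾ-preserves P resp red {π} (ρ , σ⟶*ρ , ρ≈π) Pσ = resp ρ π ρ≈π (go σ⟶*ρ Pσ)
  where
  go : ∀ {σ ρ} → Star _⟶_ σ ρ → P σ → P ρ
  go ε pσ = pσ
  go {σ} (_◅_ {j = τ} (i , j , i<j , dec , eq) rest) pσ =
    go rest (resp (transpose i j ∘ₚ σ) τ (λ x → sym (eq x)) (red σ i<j dec pσ))

FixedBelow FixedFrom RaisedAtMost LoweredAtMost : ℕ → Permutation′ n → Set
FixedBelow    a ω = ∀ x → toℕ x < a → ω ⟨$⟩ʳ x ≡ x
FixedFrom     c ω = ∀ x → c ≤ toℕ x → ω ⟨$⟩ʳ x ≡ x
RaisedAtMost  p ω = ∀ x → toℕ (ω ⟨$⟩ʳ x) ≤ toℕ x + p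
LoweredAtMost q ω = ∀ x → toℕ x ≤ toℕ (ω ⟨$⟩ʳ x) + q

module _ (π σ : Permutation′ n) (π≤σ : π ≤ᴾ σ) where

  -- A reduction cannot touch a fixed prefix: if `i` lies in it, the smaller entry at `j` is itself
  -- a fixed point below `i`, so by injectivity it equals `j`, against `i < j`.
  fixedBelow-≤ : ∀ a → FixedBelow a σ → FixedBelow a π
  fixedBelow-≤ a = ≤ᴾ-preserves (FixedBelow a) (λ _ _ eq fix x x<a → trans (sym (eq x)) (fix x x<a))
    step {π} {σ} π≤σ
    where
    step : ∀ ω {i j} → i Fin.< j → (ω ⟨$⟩ʳ j) Fin.< (ω ⟨$⟩ʳ i) → FixedBelow a ω →
      FixedBelow a (transpose i j ∘ₚ ω)
    step ω {i} {j} i<j dec fix x x<a with transpose-cases i j x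
    ... | inj₂ (inj₂ eq) = trans (cong (ω ⟨$⟩ʳ_) eq) (fix x x<a)
    ... | inj₁ (refl , _) = contradiction ωj<i
        (<⇒≯ (subst (toℕ i <_) (sym (cong toℕ (perm-injective ω ωωj))) i<j))
      where
      ωj<i : toℕ (ω ⟨$⟩ʳ j) < toℕ i
      ωj<i = subst (λ y → toℕ (ω ⟨$⟩ʳ j) < toℕ y) (fix i x<a) dec
      ωωj : ω ⟨$⟩ʳ (ω ⟨$⟩ʳ j) ≡ ω ⟨$⟩ʳ j
      ωωj = fix _ (<-trans ωj<i x<a)
    ... | inj₂ (inj₁ (refl , _)) = contradiction
      (subst₂ _<_ (cong toℕ (fix j x<a)) (cong toℕ (fix i i<a)) dec) (<⇒≯ i<j)
      where
      i<a : toℕ i < a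
      i<a = <-trans i<j x<a

  fixedFrom-≤ : ∀ c → FixedFrom c σ → FixedFrom c π
  fixedFrom-≤ c = ≤ᴾ-preserves (FixedFrom c) (λ _ _ eq fix x c≤x → trans (sym (eq x)) (fix x c≤x))
    step {π} {σ} π≤σ
    where
    step : ∀ ω {i j} → i Fin.< j → (ω ⟨$⟩ʳ j) Fin.< (ω ⟨$⟩ʳ i) → FixedFrom c ω →
      FixedFrom c (transpose i j ∘ₚ ω)
    step ω {i} {j} i<j dec fix x c≤x with transpose-cases i j x
    ... | inj₂ (inj₂ eq) = trans (cong (ω ⟨$⟩ʳ_) eq) (fix x c≤x)
    ... | inj₂ (inj₁ (refl , _)) = contradiction j<ωi
        (<⇒≯ (subst (_< toℕ j) (sym (cong toℕ (perm-injective ω ωωi))) i<j))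
      where
      j<ωi : toℕ j < toℕ (ω ⟨$⟩ʳ i)
      j<ωi = subst (λ y → toℕ y < toℕ (ω ⟨$⟩ʳ i)) (fix j c≤x) dec
      ωωi : ω ⟨$⟩ʳ (ω ⟨$⟩ʳ i) ≡ ω ⟨$⟩ʳ i
      ωωi = fix _ (<⇒≤ (≤-<-trans c≤x j<ωi))
    ... | inj₁ (refl , _) = contradiction
      (subst₂ _<_ (cong toℕ (fix j (≤-trans c≤x (<⇒≤ i<j)))) (cong toℕ (fix i c≤x)) dec) (<⇒≯ i<j)

  -- Position `i` receives a smaller entry than before, and the larger entry moves right to `j`,
  -- where its excess over its position is smaller.
  raisedAtMost-≤ : ∀ p → RaisedAtMost p σ → RaisedAtMost p π
  raisedAtMost-≤ p = ≤ᴾ-preserves (RaisedAtMost p) (λ _ _ eq h x → subst (_≤ toℕ x + p) (cong toℕ (eq x))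
    (h x)) step {π} {σ} π≤σ
    where
    step : ∀ ω {i j} → i Fin.< j → (ω ⟨$⟩ʳ j) Fin.< (ω ⟨$⟩ʳ i) → RaisedAtMost p ω →
      RaisedAtMost p (transpose i j ∘ₚ ω)
    step ω {i} {j} i<j dec h x with transpose i j ⟨$⟩ʳ x | transpose-cases i j x
    ... | _ | inj₁ (refl , refl)        = ≤-trans (<⇒≤ dec) (h i)
    ... | _ | inj₂ (inj₁ (refl , refl)) = ≤-trans (h i) (+-monoˡ-≤ p (<⇒≤ i<j))
    ... | _ | inj₂ (inj₂ refl)          = h x

  loweredAtMost-≤ : ∀ q → LoweredAtMost q σ → LoweredAtMost q π
  loweredAtMost-≤ q = ≤ᴾ-preserves (LoweredAtMost q) (λ _ _ eq h x → subst (λ y → toℕ x ≤ y + q)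
    (cong toℕ (eq x)) (h x)) step {π} {σ} π≤σ
    where
    step : ∀ ω {i j} → i Fin.< j → (ω ⟨$⟩ʳ j) Fin.< (ω ⟨$⟩ʳ i) → LoweredAtMost q ω →
      LoweredAtMost q (transpose i j ∘ₚ ω)
    step ω {i} {j} i<j dec h x with transpose i j ⟨$⟩ʳ x | transpose-cases i j x
    ... | _ | inj₁ (refl , refl)        = ≤-trans (<⇒≤ i<j) (h j)
    ... | _ | inj₂ (inj₁ (refl , refl)) = ≤-trans (h j) (+-monoˡ-≤ q (<⇒≤ dec))
    ... | _ | inj₂ (inj₂ refl)          = h x

-- The order on length vectors implied by Bruhat order.

infix 4 _⊑_

_⊑_ : Lengths → Lengths → Set
(a ∷ m ∷ k ∷ d ∷ []) ⊑ (a′ ∷ m′ ∷ k′ ∷ d′ ∷ []) = a′ ≤ a × m ≤ m′ × k ≤ k′ × d′ ≤ d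

⊑-antisym : ∀ {v w} → v ⊑ w → w ⊑ v → v ≡ w
⊑-antisym {_ ∷ _ ∷ _ ∷ _ ∷ []} {_ ∷ _ ∷ _ ∷ _ ∷ []} (a , m , k , d) (a′ , m′ , k′ , d′)
  rewrite ≤-antisym a a′ | ≤-antisym m m′ | ≤-antisym k k′ | ≤-antisym d d′ = refl

shapeAt : ∀ {ω : Permutation′ n} {v} → ω HasShape v → ∀ {x y} (x<n : x < n) →
  shape v x ≡ y → toℕ (ω ⟨$⟩ʳ fromℕ< x<n) ≡ y
shapeAt {v = v} sh x<n eq = trans (sh _) (trans (cong (shape v) (toℕ-fromℕ< x<n)) eq)

size≥ : ∀ a m k d → a + (suc k + suc m) ≤ size (a ∷ m ∷ k ∷ d ∷ [])
size≥ a m k d = subst (a + (suc k + suc m) ≤_) (sym (lemma a m k d)) (m≤m+n _ d)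
  where
  lemma : ∀ a m k d → a + (m + (k + (d + 0))) + 2 ≡ a + (suc k + suc m) + d
  lemma = solve-∀

-- Each bound valid for `σ` passes to `π`, and one position of `π` attains it: `C₀`, the first of
-- block C, for the prefix and the raise; `B₀`, the first of block B, for the drop; `Bₘ`, the last
-- of block B, for the suffix.
≤ᴾ⇒⊑ : ∀ {π σ : Permutation′ n} {v w} → size v ≡ n → size w ≡ n → π HasShape v → σ HasShape w → π ≤ᴾ σ → v ⊑ w
≤ᴾ⇒⊑ {n} {π} {σ} {v@(a ∷ m ∷ k ∷ d ∷ [])} {w@(a′ ∷ m′ ∷ k′ ∷ d′ ∷ [])} |v| |w| shπ shσ π≤σ =
  a′≤a , m≤m′ , k≤k′ , d′≤d
  where
  at : ∀ {x y} (x<n : x < n) → shape v x ≡ y → toℕ (π ⟨$⟩ʳ fromℕ< x<n) ≡ y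
  at = shapeAt {ω = π} {v} shπ
  end : a + (suc k + suc m) ≤ n
  end = subst (_ ≤_) |v| (size≥ a m k d)
  inside : ∀ {t} → t < suc k + suc m → a + t < n
  inside t< = <-≤-trans (+-monoʳ-< a t<) end
  C₀ : a + 0 < n
  C₀ = inside z<s
  B₀ : a + (suc k + 0) < n
  B₀ = inside (+-monoʳ-< (suc k) z<s)
  Bₘ : a + (suc k + m) < n
  Bₘ = inside (+-monoʳ-< (suc k) (n<1+n m))

  a′≤a : a′ ≤ a
  a′≤a = ≮⇒≥ λ a<a′ → <⇒≢ (+-monoʳ-< a (z<s {m + 0})) (begin
    a + 0                        ≡⟨ toℕ-fromℕ< C₀ ⟨
    toℕ (fromℕ< C₀)              ≡⟨ cong toℕ (fixedBelow-≤ π σ π≤σ a′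
         (λ x x<a′ → toℕ-injective (trans (shσ x) (blockSwap-A a′ (suc m′) (suc k′) x<a′))) _
         (subst (_< a′) (sym (trans (toℕ-fromℕ< C₀) (+-identityʳ a))) a<a′)) ⟨
    toℕ (π ⟨$⟩ʳ fromℕ< C₀)       ≡⟨ at C₀ (blockSwap-C a (suc m) (suc k) z<s) ⟩
    a + (suc m + 0)              ∎)
    where open ≡-Reasoning

  c≤c′ : a + (suc k + suc m) ≤ a′ + (suc m′ + suc k′)
  c≤c′ = ≮⇒≥ λ c′<c → <⇒≢ (+-monoʳ-< a (s≤s (m≤n+m m k))) (begin
    a + m                        ≡⟨ at Bₘ (blockSwap-B a (suc m) (suc k) (n<1+n m)) ⟨
    toℕ (π ⟨$⟩ʳ fromℕ< Bₘ)       ≡⟨ cong toℕ (fixedFrom-≤ π σ π≤σ (a′ + (suc m′ + suc k′))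
         (λ x c′≤x → toℕ-injective (trans (shσ x) (blockSwap-fix a′ (suc m′) (suc k′) c′≤x))) _
         (subst (a′ + (suc m′ + suc k′) ≤_) (sym (toℕ-fromℕ< Bₘ))
           (s≤s⁻¹ (subst (suc (a′ + (suc m′ + suc k′)) ≤_) (trans (cong (a +_) (+-suc (suc k) m)) (+-suc a _))
             c′<c)))) ⟩
    toℕ (fromℕ< Bₘ)              ≡⟨ toℕ-fromℕ< Bₘ ⟩
    a + (suc k + m)              ∎)
    where open ≡-Reasoning

  m≤m′ : m ≤ m′
  m≤m′ = s≤s⁻¹ (+-cancelˡ-≤ a _ _ (subst₂ _≤_
    (trans (at C₀ (blockSwap-C a (suc m) (suc k) z<s)) (cong (a +_) (+-identityʳ (suc m))))
    (cong (_+ suc m′) (trans (toℕ-fromℕ< C₀) (+-identityʳ a)))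
    (raisedAtMost-≤ π σ π≤σ (suc m′) (λ x → subst (_≤ toℕ x + suc m′) (sym (shσ x))
      (blockSwap-≤+ a′ (suc m′) (suc k′) (toℕ x))) (fromℕ< C₀))))

  k≤k′ : k ≤ k′
  k≤k′ = s≤s⁻¹ (+-cancelˡ-≤ a _ _ (subst₂ _≤_
    (trans (toℕ-fromℕ< B₀) (cong (a +_) (+-identityʳ (suc k))))
    (cong (_+ suc k′) (trans (at B₀ (blockSwap-B a (suc m) (suc k) z<s)) (+-identityʳ a)))
    (loweredAtMost-≤ π σ π≤σ (suc k′) (λ x → subst (λ y → toℕ x ≤ y + suc k′) (sym (shσ x))
      (≤blockSwap+ a′ (suc m′) (suc k′) (toℕ x))) (fromℕ< B₀))))

  -- The end of the blocks and the suffix length add up to `n` for both vectors, so comparing the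
  -- ends reverses into a comparison of suffixes.
  d′≤d : d′ ≤ d
  d′≤d = +-cancelˡ-≤ (a + (suc m + suc k)) d′ d (≤-trans
    (+-monoˡ-≤ d′ (subst (λ x → a + x ≤ a′ + (suc m′ + suc k′)) (+-comm (suc k) (suc m)) c≤c′))
    (≤-reflexive (trans (sym (size≡′ a′ m′ k′ d′)) (trans (trans |w| (sym |v|)) (size≡′ a m k d)))))

-- Reductions of lists

infix 4 _⇝_ _⇝*_
infixr 5 _∷_

-- On lists, entries can be carried across whole blocks without arithmetic of positions; the second
-- constructor skips a common prefix.
data _⇝_ : Rel (List ℕ) 0ℓ where
  exchange : ∀ {u v} ys zs → v < u → u ∷ ys ++ v ∷ zs ⇝ v ∷ ys ++ u ∷ zs
  _∷_      : ∀ x {xs ys} → xs ⇝ ys → x ∷ xs ⇝ x ∷ ys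

_⇝*_ : Rel (List ℕ) 0ℓ
_⇝*_ = Star _⇝_

prefix : ∀ ws {xs ys} → xs ⇝* ys → ws ++ xs ⇝* ws ++ ys
prefix []       r = r
prefix (w ∷ ws) r = gmap (w ∷_) (w ∷_) (prefix ws r)

-- The entry `v` passes the elements of `us` from right to left, one exchange for each.
moveLeft : ∀ us {v} zs → All (v <_) us → us ++ v ∷ zs ⇝* v ∷ us ++ zs
moveLeft []       zs []           = ε
moveLeft (u ∷ us) zs (v<u ∷ v<us) =
  prefix [ u ] (moveLeft us zs v<us) ◅◅ exchange [] (us ++ zs) v<u ◅ ε

moveRight : ∀ {u} vs zs → All (_< u) vs → u ∷ vs ++ zs ⇝* vs ++ u ∷ zs
moveRight []       zs []           = ε
moveRight (v ∷ vs) zs (v<u ∷ vs<u) =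
  exchange [] (vs ++ zs) v<u ◅ prefix [ v ] (moveRight vs zs vs<u)

-- The function `g` is quantified after `j` because the transposed permutation it stands for can be
-- formed only once the position is known.
tabulate-replace : ∀ (f : Fin n → ℕ) ys v zs u → List.tabulate f ≡ ys ++ v ∷ zs →
  ∃[ j ] (f j ≡ v × ∀ (g : Fin n → ℕ) → g j ≡ u → (∀ x → x ≢ j → g x ≡ f x) → List.tabulate g ≡ ys ++ u ∷ zs)
tabulate-replace {suc n} f [] v zs u eq = Fin.zero , proj₁ (∷-injective eq) , λ g gj g≡f →
  cong₂ _∷_ gj (trans (tabulate-cong (λ x → g≡f (Fin.suc x) λ ())) (proj₂ (∷-injective eq)))
tabulate-replace {suc n} f (y ∷ ys) v zs u eq
  with j , fj , rest ← tabulate-replace (f ∘ Fin.suc) ys v zs u (proj₂ (∷-injective eq)) =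
  Fin.suc j , fj , λ g gj g≡f →
    cong₂ _∷_ (trans (g≡f Fin.zero λ ()) (proj₁ (∷-injective eq)))
      (rest (g ∘ Fin.suc) gj λ x x≢j → g≡f (Fin.suc x) (x≢j ∘ Fin.suc-injective))
tabulate-replace {zero} f []       v zs u ()
tabulate-replace {zero} f (y ∷ ys) v zs u ()

transpose-i : ∀ (i j : Fin n) → transpose i j ⟨$⟩ʳ i ≡ j
transpose-i i j with i Fin.≟ i
... | yes _ = refl
... | no i≢i = contradiction refl i≢i

transpose-j : ∀ (i j : Fin n) → transpose i j ⟨$⟩ʳ j ≡ i
transpose-j i j with j Fin.≟ i
... | yes j≡i = j≡i
... | no _ with j Fin.≟ j
...   | yes _  = refl
...   | no j≢j = contradiction refl j≢j

transpose-≢ : ∀ (i j x : Fin n) → x ≢ i → x ≢ j → transpose i j ⟨$⟩ʳ x ≡ x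
transpose-≢ i j x x≢i x≢j with transpose-cases i j x
... | inj₁ (x≡i , _)        = contradiction x≡i x≢i
... | inj₂ (inj₁ (x≡j , _)) = contradiction x≡j x≢j
... | inj₂ (inj₂ eq)        = eq

⇝⇒transposition : ∀ (f : Fin n → ℕ) {xs ys} → List.tabulate f ≡ xs → xs ⇝ ys →
  ∃[ i ] ∃[ j ] (i Fin.< j × f j < f i × (∀ (g : Fin n → ℕ) → g i ≡ f j → g j ≡ f i →
    (∀ x → x ≢ i → x ≢ j → g x ≡ f x) → List.tabulate g ≡ ys))
⇝⇒transposition {suc n} f eq (exchange {u} {v} ys zs v<u)
  with j , fj , rest ← tabulate-replace (f ∘ Fin.suc) ys v zs u (proj₂ (∷-injective eq)) =
  Fin.zero , Fin.suc j , z<s , subst₂ _<_ (sym fj) (sym (proj₁ (∷-injective eq))) v<u ,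
  λ g gi gj g≡f → cong₂ _∷_ (trans gi fj)
    (rest (g ∘ Fin.suc) (trans gj (proj₁ (∷-injective eq)))
      λ x x≢j → g≡f (Fin.suc x) (λ ()) (x≢j ∘ Fin.suc-injective))
⇝⇒transposition {suc n} f eq (y ∷ r)
  with i , j , i<j , dec , rest ← ⇝⇒transposition (f ∘ Fin.suc) (proj₂ (∷-injective eq)) r =
  Fin.suc i , Fin.suc j , s<s i<j , dec , λ g gi gj g≡f →
    cong₂ _∷_ (trans (g≡f Fin.zero (λ ()) (λ ())) (proj₁ (∷-injective eq)))
      (rest (g ∘ Fin.suc) gi gj λ x x≢i x≢j →
        g≡f (Fin.suc x) (x≢i ∘ Fin.suc-injective) (x≢j ∘ Fin.suc-injective))
⇝⇒transposition {zero} f () (exchange ys zs v<u)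
⇝⇒transposition {zero} f () (y ∷ r)

⇝⇒⟶ : ∀ (σ : Permutation′ n) {xs ys} → oneLine σ ≡ xs → xs ⇝ ys →
  ∃[ ρ ] (σ ⟶ ρ × oneLine ρ ≡ ys)
⇝⇒⟶ σ eq r with i , j , i<j , dec , rest ← ⇝⇒transposition (suc ∘ toℕ ∘ (σ ⟨$⟩ʳ_)) eq r =
  transpose i j ∘ₚ σ , (i , j , i<j , s<s⁻¹ dec , λ _ → refl) ,
  rest _ (cong (λ x → suc (toℕ (σ ⟨$⟩ʳ x))) (transpose-i i j))
         (cong (λ x → suc (toℕ (σ ⟨$⟩ʳ x))) (transpose-j i j))
         (λ x x≢i x≢j → cong (λ x → suc (toℕ (σ ⟨$⟩ʳ x))) (transpose-≢ i j x x≢i x≢j))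

oneLine-injective : ∀ (π σ : Permutation′ n) → oneLine π ≡ oneLine σ → π Perm.≈ σ
oneLine-injective π σ eq i = toℕ-injective (suc-injective (tabulate-injective eq i))

⇝*⇒≤ᴾ : ∀ (π σ : Permutation′ n) {xs} → oneLine σ ≡ xs → xs ⇝* oneLine π → π ≤ᴾ σ
⇝*⇒≤ᴾ π σ eq ε = σ , ε , oneLine-injective σ π eq
⇝*⇒≤ᴾ π σ eq (r ◅ rs) with ρ , σ⟶ρ , eq′ ← ⇝⇒⟶ σ eq r
  with τ , ρ⟶*τ , τ≈π ← ⇝*⇒≤ᴾ π ρ eq′ rs = τ , σ⟶ρ ◅ ρ⟶*τ , τ≈π

⟶-respˡ : ∀ (ρ σ τ : Permutation′ n) → ρ Perm.≈ σ → σ ⟶ τ → ρ ⟶ τ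
⟶-respˡ ρ σ τ ρ≈σ (i , j , i<j , dec , eq) =
  i , j , i<j , subst₂ Fin._<_ (sym (ρ≈σ j)) (sym (ρ≈σ i)) dec , λ x → trans (eq x) (sym (ρ≈σ _))

-- The two chains meet only up to pointwise equality, so the first reduction out of `σ` is made to
-- start at `ρ` instead.
≤ᴾ-trans : ∀ (π σ τ : Permutation′ n) → π ≤ᴾ σ → σ ≤ᴾ τ → π ≤ᴾ τ
≤ᴾ-trans π σ τ (_ , ε , σ≈π) (ρ , τ⟶*ρ , ρ≈σ) = ρ , τ⟶*ρ , λ x → trans (ρ≈σ x) (σ≈π x)
≤ᴾ-trans π σ τ (ρ′ , _◅_ {j = υ} step steps , ρ′≈π) (ρ , τ⟶*ρ , ρ≈σ) =
  ρ′ , τ⟶*ρ ◅◅ ⟶-respˡ ρ σ υ ρ≈σ step ◅ steps , ρ′≈π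

-- The arrow in a constructor's name shows which ℓᵢ gives a unit to which ℓⱼ; the smaller element is
-- the first argument.
data Step : Rel Lengths 0ℓ where
  1→2 : ∀ {a m k d} → Step (suc a ∷ m ∷ k ∷ d ∷ []) (a ∷ suc m ∷ k ∷ d ∷ [])
  1→3 : ∀ {a m k d} → Step (suc a ∷ m ∷ k ∷ d ∷ []) (a ∷ m ∷ suc k ∷ d ∷ [])
  4→2 : ∀ {a m k d} → Step (a ∷ m ∷ k ∷ suc d ∷ []) (a ∷ suc m ∷ k ∷ d ∷ [])
  4→3 : ∀ {a m k d} → Step (a ∷ m ∷ k ∷ suc d ∷ []) (a ∷ m ∷ suc k ∷ d ∷ [])

run-∷ : ∀ s l → run s (suc l) ≡ suc s ∷ run (suc s) l
run-∷ s l = cong₂ _∷_ (cong suc (+-identityʳ s)) (applyUpTo-cong (λ t → cong suc (+-suc s t)) l)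

run-∷ʳ : ∀ s l → run s (suc l) ≡ run s l ∷ʳ suc (s + l)
run-∷ʳ s l = sym (applyUpTo-∷ʳ (λ t → suc (s + t)) l)

run-∷ʳ-++ : ∀ s l xs → run s (suc l) ++ xs ≡ run s l ++ suc (s + l) ∷ xs
run-∷ʳ-++ s l xs = trans (cong (_++ xs) (run-∷ʳ s l)) (++-assoc (run s l) [ _ ] xs)

run-> : ∀ {v s} l → v ≤ s → All (v <_) (run s l)
run-> {s = s} l v≤s = applyUpTo⁺₁ (λ t → suc (s + t)) l λ {t} _ → s≤s (≤-trans v≤s (m≤m+n s t))

run-< : ∀ {u} s l → s + l < u → All (_< u) (run s l)
run-< {u} s l s+l<u = applyUpTo⁺₁ (λ t → suc (s + t)) l λ {t} t<l → ≤-<-trans (+-monoʳ-< s t<l) s+l<u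

Step⇒⇝* : ∀ {v w} → Step v w → line w ⇝* line v
-- The first entry of block B moves left across block C and joins the prefix.
Step⇒⇝* (1→2 {a} {m} {k} {d}) = subst₂ _⇝*_
  (sym (cong (λ x → run 0 a ++ run (a + suc (suc m)) (suc k) ++ x)
     (cong (_++ run (a + suc (suc m) + suc k) d) (run-∷ a (suc m)))))
  (sym (trans (run-∷ʳ-++ 0 a _) (cong (run 0 a ++_) (cong (suc a ∷_)
    (cong₂ _++_ (cong (λ s → run s (suc k)) eq) (cong (run (suc a) (suc m) ++_)
       (cong (λ s → run (s + suc k) d) eq)))))))
  (prefix (run 0 a) (moveLeft (run (a + suc (suc m)) (suc k)) _
    (run-> (suc k) (≤-trans (s≤s (m≤m+n a (suc m))) (≤-reflexive (sym (+-suc a (suc m))))))))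
  where
  eq : suc a + suc m ≡ a + suc (suc m)
  eq = sym (+-suc a (suc m))
-- The first entries of C and B are exchanged: the smaller joins the prefix, the larger moves on to
-- the end of B.
Step⇒⇝* (1→3 {a} {m} {k} {d}) = subst₂ _⇝*_
  (sym (cong (run 0 a ++_) (cong₂ _++_ (run-∷ (a + suc m) (suc k))
    (cong (_++ run (a + suc m + suc (suc k)) d) (run-∷ a m)))))
  (sym (trans (run-∷ʳ-++ 0 a _) (cong (run 0 a ++_) (cong (suc a ∷_) (cong (run (suc (a + suc m)) (suc k) ++_)
    (trans (run-∷ʳ-++ (suc a) m _) (cong₂ (λ x s → run (suc a) m ++ x ∷ run s d)
       (cong suc (sym (+-suc a m))) (sym (+-suc (a + suc m) (suc k))))))))))
  (prefix (run 0 a) (exchange (run (suc (a + suc m)) (suc k)) _ (s<s (m<m+n a z<s)) ◅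
    prefix (suc a ∷ run (suc (a + suc m)) (suc k)) (moveRight (run (suc a) m) _
      (run-< (suc a) m (s≤s (≤-reflexive (sym (+-suc a m))))))))
-- The last entries of C and B are exchanged: the larger joins the suffix, the smaller moves left to
-- the front of C.
Step⇒⇝* (4→2 {a} {m} {k} {d}) = subst₂ _⇝*_
  (sym (cong (run 0 a ++_) (trans (run-∷ʳ-++ (a + suc (suc m)) k _)
    (cong (λ xs → run (a + suc (suc m)) k ++ suc (a + suc (suc m) + k) ∷ xs)
      (run-∷ʳ-++ a (suc m) _)))))
  (sym (cong (run 0 a ++_) (trans (cong (_++ (run a (suc m) ++ run (a + suc m + suc k) (suc d)))
    (run-∷ (a + suc m) k))
    (cong (λ xs → suc (a + suc m) ∷ xs) (cong₂ _++_ (cong (λ s → run s k) (sym (+-suc a (suc m))))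
      (cong (run a (suc m) ++_) (trans (run-∷ (a + suc m + suc k) d)
        (cong₂ (λ x y → suc x ∷ run y d) eq₁ eq₂))))))))
  (prefix (run 0 a) (prefix (run (a + suc (suc m)) k)
     (exchange (run a (suc m)) _ (s<s (≤-trans (≤-reflexive (sym (+-suc a (suc m)))) (m≤m+n _ k))) ◅ ε)
    ◅◅ moveLeft (run (a + suc (suc m)) k) _ (run-> k (≤-reflexive (sym (+-suc a (suc m)))))))
  where
  eq₁ : a + suc m + suc k ≡ a + suc (suc m) + k
  eq₁ = trans (+-suc (a + suc m) k) (cong (_+ k) (sym (+-suc a (suc m))))
  eq₂ : suc (a + suc m + suc k) ≡ a + suc (suc m) + suc k
  eq₂ = cong (_+ suc k) (sym (+-suc a (suc m)))
-- The last entry of C moves right across B and joins the suffix.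
Step⇒⇝* (4→3 {a} {m} {k} {d}) = subst₂ _⇝*_
  (sym (cong (run 0 a ++_) (run-∷ʳ-++ (a + suc m) (suc k) _)))
  (cong (run 0 a ++_) (cong (run (a + suc m) (suc k) ++_) (cong (run a (suc m) ++_)
    (sym (trans (run-∷ (a + suc m + suc k) d) (cong (λ s → suc (a + suc m + suc k) ∷ run s d)
      (sym (+-suc (a + suc m) (suc k)))))))))
  (prefix (run 0 a) (prefix (run (a + suc m) (suc k)) (moveRight (run a (suc m)) _
    (run-< a (suc m) (s≤s (m≤m+n (a + suc m) (suc k)))))))

-- The cover relation

-- Reflexivity of Bruhat order, read through `≤ᴾ⇒⊑` in both directions, gives equality by
-- antisymmetry.
shape-unique : ∀ (ω : Permutation′ n) {v w} → size v ≡ n → size w ≡ n → ω HasShape v → ω HasShape w → v ≡ w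
shape-unique ω {v} {w} |v| |w| sv sw = ⊑-antisym
  (≤ᴾ⇒⊑ {π = ω} {ω} {v} {w} |v| |w| sv sw refl≤) (≤ᴾ⇒⊑ {π = ω} {ω} {w} {v} |w| |v| sw sv refl≤)
  where
  refl≤ : ω ≤ᴾ ω
  refl≤ = ω , ε , λ _ → refl

opaque
  lengths : Bigrassmannian n → Lengths
  lengths ω = proj₁ (classify ω)

  size-lengths : ∀ (ω : Bigrassmannian n) → size (lengths ω) ≡ n
  size-lengths ω = proj₁ (proj₂ (classify ω))

  shape-lengths : ∀ (ω : Bigrassmannian n) → perm ω HasShape lengths ω
  shape-lengths ω = proj₂ (proj₂ (classify ω))

lengths-unique : ∀ (ω : Bigrassmannian n) {v} → size v ≡ n → perm ω HasShape v → lengths ω ≡ v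
lengths-unique ω |v| sh = shape-unique (perm ω) (size-lengths ω) |v| (shape-lengths ω) sh

lengths-fromLengths : ∀ v (|v|≡n : size v ≡ n) → lengths (fromLengths v |v|≡n) ≡ v
lengths-fromLengths v |v|≡n = lengths-unique (fromLengths v |v|≡n) |v|≡n (shape-fromLengths v |v|≡n)

lengths-cong : ∀ {π σ : Bigrassmannian n} → π ≈ᴮ σ → lengths π ≡ lengths σ
lengths-cong {π = π} {σ} π≈σ = lengths-unique π (size-lengths σ) λ i →
  trans (cong toℕ (π≈σ i)) (shape-lengths σ i)

lengths-injective : ∀ {π σ : Bigrassmannian n} → lengths π ≡ lengths σ → π ≈ᴮ σ
lengths-injective {π = π} {σ} eq i = toℕ-injective
  (trans (shape-lengths π i) (trans (cong (λ v → shape v (toℕ i)) eq) (sym (shape-lengths σ i))))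

≤ᴮ⇒⊑ : ∀ (π σ : Bigrassmannian n) → π ≤ᴮ σ → lengths π ⊑ lengths σ
≤ᴮ⇒⊑ π σ = ≤ᴾ⇒⊑ {π = perm π} {perm σ} (size-lengths π) (size-lengths σ) (shape-lengths π) (shape-lengths σ)

-- The corank. It falls by one with every step, which makes it the recursion measure and the reason
-- why steps are covers.
outer : Lengths → ℕ
outer (a ∷ m ∷ k ∷ d ∷ []) = a + d

Step-outer : ∀ {v w} → Step v w → outer v ≡ suc (outer w)
Step-outer 1→2               = refl
Step-outer 1→3               = refl
Step-outer (4→2 {a} {d = d}) = +-suc a d
Step-outer (4→3 {a} {d = d}) = +-suc a d

Step-size : ∀ {v w} → Step v w → size v ≡ size w
Step-size (1→2 {a} {m} {k} {d}) = lemma a m k d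
  where
  lemma : ∀ a m k d → suc a + (m + (k + (d + 0))) + 2 ≡ a + (suc m + (k + (d + 0))) + 2
  lemma = solve-∀
Step-size (1→3 {a} {m} {k} {d}) = lemma a m k d
  where
  lemma : ∀ a m k d → suc a + (m + (k + (d + 0))) + 2 ≡ a + (m + (suc k + (d + 0))) + 2
  lemma = solve-∀
Step-size (4→2 {a} {m} {k} {d}) = lemma a m k d
  where
  lemma : ∀ a m k d → a + (m + (k + (suc d + 0))) + 2 ≡ a + (suc m + (k + (d + 0))) + 2
  lemma = solve-∀
Step-size (4→3 {a} {m} {k} {d}) = lemma a m k d
  where
  lemma : ∀ a m k d → a + (m + (k + (suc d + 0))) + 2 ≡ a + (m + (suc k + (d + 0))) + 2
  lemma = solve-∀

private
  outer+inner : ∀ a m k d → a + (m + (k + (d + 0))) + 2 ≡ (a + d) + (m + k) + 2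
  outer+inner = solve-∀

  +-mono-≡ : ∀ {x y x′ y′} → x ≤ x′ → y ≤ y′ → x + y ≡ x′ + y′ → x ≡ x′ × y ≡ y′
  +-mono-≡ {x} {y} {x′} {y′} x≤x′ y≤y′ eq with m≤n⇒m<n∨m≡n x≤x′
  ... | inj₁ x<x′ = contradiction eq (<⇒≢ (+-mono-<-≤ x<x′ y≤y′))
  ... | inj₂ refl = refl , +-cancelˡ-≡ x _ _ eq

-- Equal outer sums turn the two outer inequalities into equalities; equal sizes then do the same
-- for the middle coordinates.
⊑-outer-≡ : ∀ v w → v ⊑ w → size v ≡ size w → outer v ≡ outer w → v ≡ w
⊑-outer-≡ (a ∷ m ∷ k ∷ d ∷ []) (a′ ∷ m′ ∷ k′ ∷ d′ ∷ []) (a′≤a , m≤m′ , k≤k′ , d′≤d) s o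
  with refl , refl ← +-mono-≡ a′≤a d′≤d (sym o)
  with refl , refl ← +-mono-≡ m≤m′ k≤k′ (+-cancelˡ-≡ (a + d) _ _ (+-cancelʳ-≡ 2 _ _
    (trans (sym (outer+inner a m k d)) (trans s (outer+inner a m′ k′ d)))))
  = refl

⊑-outer-< : ∀ v w → v ⊑ w → size v ≡ size w → v ≢ w → outer w < outer v
⊑-outer-< v@(a ∷ m ∷ k ∷ d ∷ []) w@(a′ ∷ m′ ∷ k′ ∷ d′ ∷ []) v⊑w@(a′≤a , _ , _ , d′≤d) s v≢w =
  ≤∧≢⇒< (+-mono-≤ a′≤a d′≤d) λ eq → v≢w (⊑-outer-≡ v w v⊑w s (sym eq))

-- As the sizes agree, an outer coordinate that still has to drop comes with a middle one that still
-- has to rise; one unit is moved between them.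
⊑-step : ∀ v w → v ⊑ w → size v ≡ size w → v ≢ w → ∃[ u ] (Step v u × u ⊑ w)
⊑-step v@(a ∷ m ∷ k ∷ d ∷ []) w@(a′ ∷ m′ ∷ k′ ∷ d′ ∷ []) v⊑w@(a′≤a , m≤m′ , k≤k′ , d′≤d) s v≢w
  with m≤n⇒m<n∨m≡n a′≤a | m≤n⇒m<n∨m≡n d′≤d | m≤n⇒m<n∨m≡n m≤m′ | m≤n⇒m<n∨m≡n k≤k′
... | inj₁ (s≤s lt) | _ | inj₁ m<m′ | _         = _ , 1→2 , lt , m<m′ , k≤k′ , d′≤d
... | inj₁ (s≤s lt) | _ | inj₂ refl | inj₁ k<k′ = _ , 1→3 , lt , m≤m′ , k<k′ , d′≤d
... | inj₂ refl | inj₁ (s≤s lt) | inj₁ m<m′ | _         = _ , 4→2 , a′≤a , m<m′ , k≤k′ , lt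
... | inj₂ refl | inj₁ (s≤s lt) | inj₂ refl | inj₁ k<k′ = _ , 4→3 , a′≤a , m≤m′ , k<k′ , lt
... | inj₂ refl | inj₂ refl     | _         | _         = contradiction (⊑-outer-≡ v w v⊑w s refl) v≢w
... | inj₁ _ | _ | inj₂ refl | inj₂ refl = contradiction
  (+-cancelʳ-≡ (m + k) _ _
    (+-cancelʳ-≡ 2 _ _ (trans (sym (outer+inner a′ m k d′)) (trans (sym s) (outer+inner a m k d)))))
  (<⇒≢ (⊑-outer-< v w v⊑w s v≢w))
... | inj₂ refl | inj₁ _ | inj₂ refl | inj₂ refl = contradiction
  (+-cancelʳ-≡ (m + k) _ _
    (+-cancelʳ-≡ 2 _ _ (trans (sym (outer+inner a′ m k d′)) (trans (sym s) (outer+inner a m k d)))))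
  (<⇒≢ (⊑-outer-< v w v⊑w s v≢w))

Step⇒≤ᴮ : ∀ (π σ : Bigrassmannian n) → Step (lengths π) (lengths σ) → π ≤ᴮ σ
Step⇒≤ᴮ π σ step = ⇝*⇒≤ᴾ (perm π) (perm σ)
  (shape⇒line (perm σ) (lengths σ) (size-lengths σ) (shape-lengths σ))
  (subst (line (lengths σ) ⇝*_)
    (sym (shape⇒line (perm π) (lengths π) (size-lengths π) (shape-lengths π)))
    (Step⇒⇝* step))

-- Repeated use of `⊑-step` climbs from `π` to `σ`, each intermediate vector being realised by a
-- permutation.
⊑⇒≤ᴮ : ∀ (π σ : Bigrassmannian n) → lengths π ⊑ lengths σ → π ≤ᴮ σ
⊑⇒≤ᴮ {n} π σ = go (outer (lengths π)) π refl
  where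
  go : ∀ o (π : Bigrassmannian n) → outer (lengths π) ≡ o → lengths π ⊑ lengths σ → π ≤ᴮ σ
  go o π out π⊑σ with ≡-dec _≟_ (lengths π) (lengths σ)
  ... | yes eq = perm σ , ε , lengths-injective {π = σ} {π} (sym eq)
  ... | no neq with u , step , u⊑σ ← ⊑-step (lengths π) (lengths σ) π⊑σ
      (trans (size-lengths π) (sym (size-lengths σ))) neq = next o out
    where
    |u|≡n : size u ≡ n
    |u|≡n = trans (sym (Step-size step)) (size-lengths π)
    τ : Bigrassmannian n
    τ = fromLengths u |u|≡n
    τ≡u : lengths τ ≡ u
    τ≡u = lengths-fromLengths u |u|≡n
    next : ∀ o → outer (lengths π) ≡ o → π ≤ᴮ σ
    next zero    out = contradiction (trans (sym out) (Step-outer step)) 0≢1+n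
    next (suc o) out = ≤ᴾ-trans (perm π) (perm τ) (perm σ)
      (Step⇒≤ᴮ π τ (subst (Step (lengths π)) (sym τ≡u) step))
      (go o τ (suc-injective (trans (cong (suc ∘ outer) τ≡u) (trans (sym (Step-outer step)) out)))
        (subst (_⊑ lengths σ) (sym τ≡u) u⊑σ))

Step⇒≢ : ∀ {v w} → Step v w → v ≢ w
Step⇒≢ step refl = contradiction (Step-outer step) (<⇒≢ (n<1+n _))

-- The first step towards `σ` lands strictly above `π` and not beyond `σ`, hence on `σ` itself.
⋖⇒Step : ∀ (π σ : Bigrassmannian n) → π ⋖ σ → Step (lengths π) (lengths σ)
⋖⇒Step {n} π σ ((π≤σ , π≉σ) , nothingBetween) 
  with u , step , u⊑σ ← ⊑-step (lengths π) (lengths σ) (≤ᴮ⇒⊑ π σ π≤σ)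
    (trans (size-lengths π) (sym (size-lengths σ))) (λ eq → π≉σ (lengths-injective {π = π} {σ} eq))
  with ≡-dec _≟_ u (lengths σ)
... | yes refl = step
... | no u≢σ   = contradiction
  (τ , (Step⇒≤ᴮ π τ step′ , λ π≈τ → Step⇒≢ step′ (lengths-cong {π = π} {τ} π≈τ))
     , (⊑⇒≤ᴮ τ σ (subst (_⊑ lengths σ) (sym τ≡u) u⊑σ) ,
        λ τ≈σ → u≢σ (trans (sym τ≡u) (lengths-cong {π = τ} {σ} τ≈σ))))
  nothingBetween
  where
  |u|≡n : size u ≡ n
  |u|≡n = trans (sym (Step-size step)) (size-lengths π)
  τ : Bigrassmannian n
  τ = fromLengths u |u|≡n
  τ≡u : lengths τ ≡ u
  τ≡u = lengths-fromLengths u |u|≡n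
  step′ : Step (lengths π) (lengths τ)
  step′ = subst (Step (lengths π)) (sym τ≡u) step

<ᴮ⇒outer-> : ∀ (π σ : Bigrassmannian n) → π <ᴮ σ → outer (lengths σ) < outer (lengths π)
<ᴮ⇒outer-> π σ (π≤σ , π≉σ) = ⊑-outer-< (lengths π) (lengths σ) (≤ᴮ⇒⊑ π σ π≤σ)
  (trans (size-lengths π) (sym (size-lengths σ))) (λ eq → π≉σ (lengths-injective {π = π} {σ} eq))

-- Two successive strict inequalities lower `outer` by at least two, a step by exactly one.
Step⇒⋖ : ∀ (π σ : Bigrassmannian n) → Step (lengths π) (lengths σ) → π ⋖ σ
Step⇒⋖ π σ step = (Step⇒≤ᴮ π σ step , λ π≈σ → Step⇒≢ step (lengths-cong {π = π} {σ} π≈σ)) ,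
  λ (τ , π<τ , τ<σ) → <⇒≱ (<ᴮ⇒outer-> π τ π<τ)
    (subst (_≤ outer (lengths τ)) (sym (Step-outer step)) (<ᴮ⇒outer-> τ σ τ<σ))

-- Butterflies as squares of length vectors

hasLengths : ∀ (ω : Bigrassmannian n) → HasLengths ω (Vec.map suc (lengths ω))
hasLengths {n} ω with lengths ω | size-lengths ω | shape-lengths ω
... | v@(a ∷ m ∷ k ∷ d ∷ []) | |v|≡n | sh =
  a , b , c , m<m+n a z<s , m<m+n b z<s ,
  subst (c ≤_) c+d≡n (m≤m+n c d) ,
  trans (shape⇒line (perm ω) v |v|≡n sh)
    (cong (run 0 a List.++_) (cong₂ List._++_ (cong (run b) (sym c∸b))
      (cong₂ List._++_ (cong (run a) (sym b∸a)) (cong (run c) (sym n∸c))))) ,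
  cong (suc a ∷_) (cong₂ _∷_ (sym b∸a) (cong₂ _∷_ (sym c∸b) (cong (_∷ []) (sym 1+n∸c))))
  where
  b c : ℕ
  b = a + suc m
  c = b + suc k
  b∸a : b ∸ a ≡ suc m
  b∸a = m+n∸m≡n a (suc m)
  c∸b : c ∸ b ≡ suc k
  c∸b = m+n∸m≡n b (suc k)
  c+d≡n : c + d ≡ n
  c+d≡n = trans (lemma a m k d) |v|≡n
    where
    lemma : ∀ a m k d → a + suc m + suc k + d ≡ a + (m + (k + (d + 0))) + 2
    lemma = solve-∀
  n∸c : n ∸ c ≡ d
  n∸c = trans (cong (_∸ c) (sym c+d≡n)) (m+n∸m≡n c d)
  1+n∸c : suc n ∸ c ≡ suc d
  1+n∸c = trans (cong (_∸ c) (trans (cong suc (sym c+d≡n)) (sym (+-suc c d)))) (m+n∸m≡n c (suc d))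

hasLengths-unique : ∀ (ω : Bigrassmannian n) {ℓ} → HasLengths ω ℓ → ℓ ≡ Vec.map suc (lengths ω)
hasLengths-unique {n} ω (a , b , c , a<b , b<c , c≤n , line≡ , refl)
  with m , refl ← m≤n⇒∃[o]m+o≡n a<b
  with k , refl ← m≤n⇒∃[o]m+o≡n b<c
  with d , refl ← m≤n⇒∃[o]m+o≡n c≤n = trans
    (cong (suc a ∷_) (cong₂ _∷_ b∸a (cong₂ _∷_ c∸b (cong (_∷ []) 1+n∸c))))
    (cong (Vec.map suc) (sym (lengths-unique ω {v} |v|
      (line⇒shape (perm ω) v |v| (trans line≡
        (cong (run 0 a List.++_) (cong₂ List._++_ (cong₂ run (sym (+-suc a m)) c∸b)
      (cong₂ List._++_ (cong (run a) b∸a) (cong₂ run c≡ (m+n∸m≡n c₀ d))))))))))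
  where
  v : Lengths
  v = a ∷ m ∷ k ∷ d ∷ []
  b₀ c₀ : ℕ
  b₀ = suc a + m
  c₀ = suc b₀ + k
  |v| : size v ≡ c₀ + d
  |v| = lemma a m k d
    where
    lemma : ∀ a m k d → a + (m + (k + (d + 0))) + 2 ≡ suc (suc a + m) + k + d
    lemma = solve-∀
  b∸a : b₀ ∸ a ≡ suc m
  b∸a = trans (cong (_∸ a) (sym (+-suc a m))) (m+n∸m≡n a (suc m))
  c∸b : c₀ ∸ b₀ ≡ suc k
  c∸b = trans (cong (_∸ b₀) (sym (+-suc b₀ k))) (m+n∸m≡n b₀ (suc k))
  c≡ : c₀ ≡ a + suc m + suc k
  c≡ = trans (sym (+-suc b₀ k)) (cong (_+ suc k) (sym (+-suc a m)))
  1+n∸c : suc (c₀ + d) ∸ c₀ ≡ suc d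
  1+n∸c = trans (cong (_∸ c₀) (sym (+-suc c₀ d))) (m+n∸m≡n c₀ (suc d))

hasLength-1⇒ : ∀ (ω : Bigrassmannian n) {i} → HasLength ω i 1 → lookup (lengths ω) i ≡ 0
hasLength-1⇒ ω {i} (ℓ , has , eq) = suc-injective (trans (sym (lookup-map i suc (lengths ω)))
  (trans (cong (λ ℓ → lookup ℓ i) (sym (hasLengths-unique ω has))) eq))

⇒hasLength-1 : ∀ (ω : Bigrassmannian n) {i} → lookup (lengths ω) i ≡ 0 → HasLength ω i 1
⇒hasLength-1 ω {i} eq = _ , hasLengths ω , trans (lookup-map i suc (lengths ω)) (cong suc eq)

inner : Lengths → ℕ
inner (a ∷ m ∷ k ∷ d ∷ []) = m + k

hasRank : ∀ (ω : Bigrassmannian n) → HasRank ω (inner (lengths ω))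
hasRank ω = _ , hasLengths ω , rank≡ (lengths ω)
  where
  rank≡ : ∀ v → lookup (Vec.map suc v) 1F + lookup (Vec.map suc v) 2F ∸ 2 ≡ inner v
  rank≡ (a ∷ m ∷ k ∷ d ∷ []) = cong (_∸ 1) (+-suc m k)

Step-inner : ∀ {v w} → Step v w → inner w ≡ suc (inner v)
Step-inner 1→2                   = refl
Step-inner (1→3 {m = m} {k = k}) = +-suc m k
Step-inner 4→2                   = refl
Step-inner (4→3 {m = m} {k = k}) = +-suc m k

lengthsList : Butterfly n → List Lengths
lengthsList X = List.map lengths (Butterfly.elements X)

module _ {n : ℕ} where

  open Setoid (butterflySetoid n) public using () renaming (_≈_ to _≈ᵇ_)

∈ᵇ⇒∈ : ∀ {ω : Bigrassmannian n} (X : Butterfly n) → ω ∈ᵇ X → lengths ω ∈ lengthsList X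
∈ᵇ⇒∈ {ω = ω} X ω∈X = Any.map⁺ (Any.map (λ {τ} → lengths-cong {π = ω} {τ}) ω∈X)

∈⇒∈ᵇ : ∀ {ω : Bigrassmannian n} (X : Butterfly n) → lengths ω ∈ lengthsList X → ω ∈ᵇ X
∈⇒∈ᵇ {ω = ω} X ω∈X = Any.map (λ {τ} → lengths-injective {π = ω} {τ}) (Any.map⁻ ω∈X)

module _ {n : ℕ} (X Y : Butterfly n) where

  ↭⇒≈ᵇ : lengthsList X ↭ lengthsList Y → X ≈ᵇ Y
  ↭⇒≈ᵇ X↭Y = (λ {ω} ω∈X → ∈⇒∈ᵇ {ω = ω} Y (∈-resp-↭ X↭Y (∈ᵇ⇒∈ {ω = ω} X ω∈X)))
           , (λ {ω} ω∈Y → ∈⇒∈ᵇ {ω = ω} X (∈-resp-↭ (↭-sym X↭Y) (∈ᵇ⇒∈ {ω = ω} Y ω∈Y)))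

  -- Butterflies are compared through permutations, so `size v ≡ n` is used to realise `v` by one.
  ≈ᵇ⇒⊆ : X ≈ᵇ Y → ∀ {v} → size v ≡ n → v ∈ lengthsList X → v ∈ lengthsList Y
  ≈ᵇ⇒⊆ (X⊆Y , _) {v} |v|≡n v∈X = subst (_∈ lengthsList Y) eq
    (∈ᵇ⇒∈ {ω = ω} Y (X⊆Y {ω} (∈⇒∈ᵇ {ω = ω} X (subst (_∈ lengthsList X) (sym eq) v∈X))))
    where
    ω : Bigrassmannian n
    ω = fromLengths v |v|≡n
    eq : lengths ω ≡ v
    eq = lengths-fromLengths v |v|≡n

-- A butterfly on the level of vectors: ranks, the other sizes and the remaining inequalities follow
-- from the four steps.
record Square (n : ℕ) : Set where
  field
    p₁ p₂ s₁ s₂ : Lengths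
    |p₁|        : size p₁ ≡ n
    p₁→s₁       : Step p₁ s₁
    p₁→s₂       : Step p₁ s₂
    p₂→s₁       : Step p₂ s₁
    p₂→s₂       : Step p₂ s₂
    p₁≢p₂       : p₁ ≢ p₂
    s₁≢s₂       : s₁ ≢ s₂

  corners : List Lengths
  corners = p₁ ∷ p₂ ∷ s₁ ∷ s₂ ∷ []

module _ (S : Square n) where

  open Square S

  private
    |s₁| : size s₁ ≡ n
    |s₁| = trans (sym (Step-size p₁→s₁)) |p₁|
    |s₂| : size s₂ ≡ n
    |s₂| = trans (sym (Step-size p₁→s₂)) |p₁|
    |p₂| : size p₂ ≡ n
    |p₂| = trans (Step-size p₂→s₁) |s₁|

    ω : ∀ v → size v ≡ n → Bigrassmannian n
    ω = fromLengths

    lengths-ω : ∀ v (|v| : size v ≡ n) → lengths (ω v |v|) ≡ v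
    lengths-ω = lengths-fromLengths

    ω-⋖ : ∀ {v w} (|v| : size v ≡ n) (|w| : size w ≡ n) → Step v w → ω v |v| ⋖ ω w |w|
    ω-⋖ {v} {w} |v| |w| step = Step⇒⋖ (ω v |v|) (ω w |w|)
      (subst₂ Step (sym (lengths-ω v |v|)) (sym (lengths-ω w |w|)) step)

    ω-≉ : ∀ {v w} (|v| : size v ≡ n) (|w| : size w ≡ n) → v ≢ w → ¬ ω v |v| ≈ᴮ ω w |w|
    ω-≉ {v} {w} |v| |w| v≢w eq = v≢w (trans (sym (lengths-ω v |v|))
      (trans (lengths-cong {π = ω v |v|} {ω w |w|} eq) (lengths-ω w |w|)))

    ω-rank : ∀ {v k} (|v| : size v ≡ n) → inner v ≡ k → HasRank (ω v |v|) k
    ω-rank {v} |v| eq = subst (HasRank (ω v |v|)) (trans (cong inner (lengths-ω v |v|)) eq)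
      (hasRank (ω v |v|))

  opaque
    square⇒butterfly : Butterfly n
    square⇒butterfly = record
      { π₁ = ω p₁ |p₁| ; π₂ = ω p₂ |p₂| ; σ₁ = ω s₁ |s₁| ; σ₂ = ω s₂ |s₂|
      ; distinct = (ω-≉ |p₁| |p₂| p₁≢p₂ ∷ ω-≉ |p₁| |s₁| (Step⇒≢ p₁→s₁) ∷ ω-≉ |p₁| |s₂| (Step⇒≢ p₁→s₂) ∷ [])
                 ∷ (ω-≉ |p₂| |s₁| (Step⇒≢ p₂→s₁) ∷ ω-≉ |p₂| |s₂| (Step⇒≢ p₂→s₂) ∷ [])
                 ∷ (ω-≉ |s₁| |s₂| s₁≢s₂ ∷ [])
                 ∷ [] ∷ []
      ; k = inner p₁
      ; rank-π₁ = ω-rank |p₁| refl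
      ; rank-π₂ = ω-rank |p₂| (suc-injective (trans (sym (Step-inner p₂→s₁)) (Step-inner p₁→s₁)))
      ; rank-σ₁ = ω-rank |s₁| (Step-inner p₁→s₁)
      ; rank-σ₂ = ω-rank |s₂| (Step-inner p₁→s₂)
      ; π₁⋖σ₁ = ω-⋖ |p₁| |s₁| p₁→s₁
      ; π₁⋖σ₂ = ω-⋖ |p₁| |s₂| p₁→s₂
      ; π₂⋖σ₁ = ω-⋖ |p₂| |s₁| p₂→s₁
      ; π₂⋖σ₂ = ω-⋖ |p₂| |s₂| p₂→s₂
      }

    lengthsList-square : lengthsList square⇒butterfly ≡ corners
    lengthsList-square = cong₂ _∷_ (lengths-ω p₁ |p₁|) (cong₂ _∷_ (lengths-ω p₂ |p₂|)
      (cong₂ _∷_ (lengths-ω s₁ |s₁|) (cong (_∷ []) (lengths-ω s₂ |s₂|))))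

-- The two families of squares.

bump : Fin 4 → Lengths → Lengths
bump c v = updateAt v c suc

bumpOthers : Fin 4 → Lengths → Lengths
bumpOthers c v = updateAt (Vec.map suc v) c pred

aboveSquare : (v : Lengths) → Vec.sum v + 3 ≡ n → Square n
aboveSquare v@(a ∷ m ∷ k ∷ d ∷ []) eq = record
  { p₁ = bump 0F v ; p₂ = bump 3F v ; s₁ = bump 1F v ; s₂ = bump 2F v
  ; |p₁| = trans (lemma (Vec.sum v)) eq
  ; p₁→s₁ = 1→2 ; p₁→s₂ = 1→3 ; p₂→s₁ = 4→2 ; p₂→s₂ = 4→3
  ; p₁≢p₂ = λ () ; s₁≢s₂ = λ () }
  where
  lemma : ∀ s → suc s + 2 ≡ s + 3
  lemma = solve-∀

sum+3≡n∸2⇒ : ∀ (v : Lengths) → Vec.sum v + 3 ≡ n ∸ 2 → 2 + (Vec.sum v + 3) ≡ n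
sum+3≡n∸2⇒ {n} v eq = trans (cong (2 +_) eq) (m+[n∸m]≡n 2≤n)
  where
  -- For `n ≤ 2` the subtraction gives 0, which `Vec.sum v + 3` cannot equal.
  2≤n : 2 ≤ n
  2≤n = ≰⇒≥ λ n≤2 → contradiction (trans (+-comm 3 (Vec.sum v)) (trans eq (m≤n⇒m∸n≡0 n≤2))) λ ()

-- Omitting a middle coordinate gives a lower element, omitting an outer one an upper element. The
-- vertices have sum `Vec.sum v + 3`, and `size` adds 2; moving that 2 to the other side gives the
-- condition the form it has in `aboveSquare`.
belowSquare : (v : Lengths) → Vec.sum v + 3 ≡ n ∸ 2 → Square n
belowSquare {n} v@(a ∷ m ∷ k ∷ d ∷ []) eq = record
  { p₁ = bumpOthers 1F v ; p₂ = bumpOthers 2F v ; s₁ = bumpOthers 0F v ; s₂ = bumpOthers 3F v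
  ; |p₁| = trans (lemma a m k d) (sum+3≡n∸2⇒ v eq)
  ; p₁→s₁ = 1→2 ; p₁→s₂ = 4→2 ; p₂→s₁ = 1→3 ; p₂→s₂ = 4→3
  ; p₁≢p₂ = λ () ; s₁≢s₂ = λ () }
  where
  lemma : ∀ a m k d → suc a + (m + (suc k + (suc d + 0))) + 2 ≡ 2 + (a + (m + (k + (d + 0))) + 3)
  lemma = solve-∀

-- The elements v + e_c, respectively v + 1 − e_c, in the order of Square.corners.
above below : Lengths → List Lengths
above v = bump 0F v ∷ bump 3F v ∷ bump 1F v ∷ bump 2F v ∷ []
below v = bumpOthers 1F v ∷ bumpOthers 2F v ∷ bumpOthers 0F v ∷ bumpOthers 3F v ∷ []

module _ {A : Set} {x₁ x₂ y₁ y₂ u v : A} where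

  ↭-pair : x₁ ≡ u ⊎ x₁ ≡ v → x₂ ≡ u ⊎ x₂ ≡ v → x₁ ≢ x₂ →
    x₁ ∷ x₂ ∷ y₁ ∷ y₂ ∷ [] ↭ u ∷ v ∷ y₁ ∷ y₂ ∷ []
  ↭-pair (inj₁ refl) (inj₁ refl) x₁≢x₂ = contradiction refl x₁≢x₂
  ↭-pair (inj₁ refl) (inj₂ refl) _     = ↭-refl
  ↭-pair (inj₂ refl) (inj₁ refl) _     = swap _ _ ↭-refl
  ↭-pair (inj₂ refl) (inj₂ refl) x₁≢x₂ = contradiction refl x₁≢x₂

Step-above : ∀ {p a m k d} → Step p (a ∷ suc m ∷ k ∷ d ∷ []) → Step p (a ∷ m ∷ suc k ∷ d ∷ []) →
  p ≡ suc a ∷ m ∷ k ∷ d ∷ [] ⊎ p ≡ a ∷ m ∷ k ∷ suc d ∷ []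
Step-above 1→2 1→3 = inj₁ refl
Step-above 4→2 4→3 = inj₂ refl

-- A common lower cover is one short in a middle coordinate, the same one for both steps, so that
-- coordinate is positive in the upper elements.
Step-below : ∀ {p a m k d} → Step p (a ∷ m ∷ k ∷ suc d ∷ []) → Step p (suc a ∷ m ∷ k ∷ d ∷ []) →
  (∃[ m′ ] m ≡ suc m′ × p ≡ suc a ∷ m′ ∷ k ∷ suc d ∷ []) ⊎
  (∃[ k′ ] k ≡ suc k′ × p ≡ suc a ∷ m ∷ k′ ∷ suc d ∷ [])
Step-below 1→2 4→2 = inj₁ (_ , refl , refl)
Step-below 1→3 4→3 = inj₂ (_ , refl , refl)

-- Two upper covers obtained by moving units between disjoint pairs of coordinates
-- have only one common lower cover, so they do not belong to a butterfly.
Step-opposite₁ : ∀ {p a m k d} → Step p (a ∷ suc m ∷ k ∷ suc d ∷ []) → Step p (suc a ∷ m ∷ suc k ∷ d ∷ []) →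
  p ≡ suc a ∷ m ∷ k ∷ suc d ∷ []
Step-opposite₁ 1→2 4→3 = refl

Step-opposite₂ : ∀ {p a m k d} → Step p (a ∷ m ∷ suc k ∷ suc d ∷ []) → Step p (suc a ∷ suc m ∷ k ∷ d ∷ []) →
  p ≡ suc a ∷ m ∷ k ∷ suc d ∷ []
Step-opposite₂ 1→3 4→2 = refl

module _ {p₁ p₂ : Lengths} (p₁≢p₂ : p₁ ≢ p₂) where

  private
    IsSquare : Lengths → Lengths → Set
    IsSquare s₁ s₂ = (∃[ v ] p₁ ∷ p₂ ∷ s₁ ∷ s₂ ∷ [] ↭ above v) ⊎ (∃[ v ] p₁ ∷ p₂ ∷ s₁ ∷ s₂ ∷ [] ↭ below v)

    swapped : ∀ {s₁ s₂} → IsSquare s₂ s₁ → IsSquare s₁ s₂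
    swapped (inj₁ (v , r)) = inj₁ (v , ↭-trans (prep _ (prep _ (swap _ _ ↭-refl))) r)
    swapped (inj₂ (v , r)) = inj₂ (v , ↭-trans (prep _ (prep _ (swap _ _ ↭-refl))) r)

    isAbove : ∀ {a m k d} → (∀ {p} → p ≡ p₁ ⊎ p ≡ p₂ → Step p (a ∷ suc m ∷ k ∷ d ∷ []) ×
      Step p (a ∷ m ∷ suc k ∷ d ∷ [])) →
      IsSquare (a ∷ suc m ∷ k ∷ d ∷ []) (a ∷ m ∷ suc k ∷ d ∷ [])
    isAbove {a} {m} {k} {d} steps = inj₁ (a ∷ m ∷ k ∷ d ∷ [] , ↭-pair (uncurry Step-above (steps (inj₁ refl)))
      (uncurry Step-above (steps (inj₂ refl))) p₁≢p₂)

    isBelow : ∀ {a m k d} → (∀ {p} → p ≡ p₁ ⊎ p ≡ p₂ → Step p (a ∷ m ∷ k ∷ suc d ∷ []) ×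
      Step p (suc a ∷ m ∷ k ∷ d ∷ [])) →
      IsSquare (a ∷ m ∷ k ∷ suc d ∷ []) (suc a ∷ m ∷ k ∷ d ∷ [])
    isBelow {a} {d = d} steps with uncurry Step-below (steps (inj₁ refl)) |
      uncurry Step-below (steps (inj₂ refl))
    ... | inj₁ (m , refl , refl) | inj₂ (k , refl , refl) = inj₂ (a ∷ m ∷ k ∷ d ∷ [] , ↭-refl)
    ... | inj₂ (k , refl , refl) | inj₁ (m , refl , refl) = inj₂ (a ∷ m ∷ k ∷ d ∷ [] , swap _ _ ↭-refl)
    ... | inj₁ (_ , refl , refl) | inj₁ (_ , refl , refl) = contradiction refl p₁≢p₂
    ... | inj₂ (_ , refl , refl) | inj₂ (_ , refl , refl) = contradiction refl p₁≢p₂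

    both : ∀ {s₁ s₂} → Step p₁ s₁ → Step p₁ s₂ → Step p₂ s₁ → Step p₂ s₂ →
      ∀ {p} → p ≡ p₁ ⊎ p ≡ p₂ → Step p s₁ × Step p s₂
    both p₁→s₁ p₁→s₂ _ _ (inj₁ refl) = p₁→s₁ , p₁→s₂
    both _ _ p₂→s₁ p₂→s₂ (inj₂ refl) = p₂→s₁ , p₂→s₂

  -- The two steps out of `p₁` decide: equal steps contradict `s₁ ≢ s₂`, steps sharing neither
  -- source nor target leave no second lower cover, a shared source gives `above` and a shared
  -- target `below`.
  square-above-or-below : ∀ {s₁ s₂} → Step p₁ s₁ → Step p₁ s₂ → Step p₂ s₁ → Step p₂ s₂ → s₁ ≢ s₂ →
    IsSquare s₁ s₂
  square-above-or-below 1→2 1→2 _ _ s₁≢s₂ = contradiction refl s₁≢s₂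
  square-above-or-below 1→3 1→3 _ _ s₁≢s₂ = contradiction refl s₁≢s₂
  square-above-or-below 4→2 4→2 _ _ s₁≢s₂ = contradiction refl s₁≢s₂
  square-above-or-below 4→3 4→3 _ _ s₁≢s₂ = contradiction refl s₁≢s₂
  square-above-or-below 1→2 4→3 x y _ = contradiction (sym (Step-opposite₁ x y)) p₁≢p₂
  square-above-or-below 4→3 1→2 x y _ = contradiction (sym (Step-opposite₁ y x)) p₁≢p₂
  square-above-or-below 1→3 4→2 x y _ = contradiction (sym (Step-opposite₂ x y)) p₁≢p₂
  square-above-or-below 4→2 1→3 x y _ = contradiction (sym (Step-opposite₂ y x)) p₁≢p₂
  square-above-or-below 1→2 1→3 x y _ = isAbove (both 1→2 1→3 x y)
  square-above-or-below 1→3 1→2 x y _ = swapped (isAbove (both 1→2 1→3 y x))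
  square-above-or-below 4→2 4→3 x y _ = isAbove (both 4→2 4→3 x y)
  square-above-or-below 4→3 4→2 x y _ = swapped (isAbove (both 4→2 4→3 y x))
  square-above-or-below 1→2 4→2 x y _ = isBelow (both 1→2 4→2 x y)
  square-above-or-below 4→2 1→2 x y _ = swapped (isBelow (both 1→2 4→2 y x))
  square-above-or-below 1→3 4→3 x y _ = isBelow (both 1→3 4→3 x y)
  square-above-or-below 4→3 1→3 x y _ = swapped (isBelow (both 1→3 4→3 y x))

aboveButterfly : (v : Lengths) → Vec.sum v + 3 ≡ n → Butterfly n
aboveButterfly {n} v eq = square⇒butterfly (aboveSquare {n} v eq)

belowButterfly : (v : Lengths) → Vec.sum v + 3 ≡ n ∸ 2 → Butterfly n
belowButterfly {n} v eq = square⇒butterfly (belowSquare {n} v eq)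

lengthsList-above : ∀ v (eq : Vec.sum v + 3 ≡ n) → lengthsList (aboveButterfly {n} v eq) ≡ above v
lengthsList-above {n} v@(_ ∷ _ ∷ _ ∷ _ ∷ []) eq = lengthsList-square (aboveSquare {n} v eq)

lengthsList-below : ∀ v (eq : Vec.sum v + 3 ≡ n ∸ 2) → lengthsList (belowButterfly {n} v eq) ≡ below v
lengthsList-below {n} v@(_ ∷ _ ∷ _ ∷ _ ∷ []) eq = lengthsList-square (belowSquare {n} v eq)

∈-above : ∀ c v → bump c v ∈ above v
∈-above 0F v = here refl
∈-above 1F v = there (there (here refl))
∈-above 2F v = there (there (there (here refl)))
∈-above 3F v = there (here refl)

∈-below : ∀ c v → bumpOthers c v ∈ below v
∈-below 0F v = there (there (here refl))
∈-below 1F v = here refl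
∈-below 2F v = there (here refl)
∈-below 3F v = there (there (there (here refl)))

above-∈ : ∀ {u v} → u ∈ above v → ∃[ c ] u ≡ bump c v
above-∈ (here eq)                         = 0F , eq
above-∈ (there (here eq))                 = 3F , eq
above-∈ (there (there (here eq)))         = 1F , eq
above-∈ (there (there (there (here eq)))) = 2F , eq

below-∈ : ∀ {u v} → u ∈ below v → ∃[ c ] u ≡ bumpOthers c v
below-∈ (here eq)                         = 1F , eq
below-∈ (there (here eq))                 = 2F , eq
below-∈ (there (there (here eq)))         = 0F , eq
below-∈ (there (there (there (here eq)))) = 3F , eq

size-bump : ∀ c v → size (bump c v) ≡ Vec.sum v + 3
size-bump c (a ∷ m ∷ k ∷ d ∷ []) = go c
  where
  go : ∀ c → size (bump c (a ∷ m ∷ k ∷ d ∷ [])) ≡ a + (m + (k + (d + 0))) + 3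
  go 0F = lemma a m k d
    where
    lemma : ∀ a m k d → suc a + (m + (k + (d + 0))) + 2 ≡ a + (m + (k + (d + 0))) + 3
    lemma = solve-∀
  go 1F = lemma a m k d
    where
    lemma : ∀ a m k d → a + (suc m + (k + (d + 0))) + 2 ≡ a + (m + (k + (d + 0))) + 3
    lemma = solve-∀
  go 2F = lemma a m k d
    where
    lemma : ∀ a m k d → a + (m + (suc k + (d + 0))) + 2 ≡ a + (m + (k + (d + 0))) + 3
    lemma = solve-∀
  go 3F = lemma a m k d
    where
    lemma : ∀ a m k d → a + (m + (k + (suc d + 0))) + 2 ≡ a + (m + (k + (d + 0))) + 3
    lemma = solve-∀

size-bumpOthers : ∀ c v → size (bumpOthers c v) ≡ 2 + (Vec.sum v + 3)
size-bumpOthers c (a ∷ m ∷ k ∷ d ∷ []) = go c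
  where
  go : ∀ c → size (bumpOthers c (a ∷ m ∷ k ∷ d ∷ [])) ≡ 2 + (a + (m + (k + (d + 0))) + 3)
  go 0F = lemma a m k d
    where
    lemma : ∀ a m k d → a + (suc m + (suc k + (suc d + 0))) + 2 ≡ 2 + (a + (m + (k + (d + 0))) + 3)
    lemma = solve-∀
  go 1F = lemma a m k d
    where
    lemma : ∀ a m k d → suc a + (m + (suc k + (suc d + 0))) + 2 ≡ 2 + (a + (m + (k + (d + 0))) + 3)
    lemma = solve-∀
  go 2F = lemma a m k d
    where
    lemma : ∀ a m k d → suc a + (suc m + (k + (suc d + 0))) + 2 ≡ 2 + (a + (m + (k + (d + 0))) + 3)
    lemma = solve-∀
  go 3F = lemma a m k d
    where
    lemma : ∀ a m k d → suc a + (suc m + (suc k + (d + 0))) + 2 ≡ 2 + (a + (m + (k + (d + 0))) + 3)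
    lemma = solve-∀

size-∈ : ∀ (X : Butterfly n) {v} → v ∈ lengthsList X → size v ≡ n
size-∈ X v∈X with ω , _ , refl ← ∈-map⁻ lengths v∈X = size-lengths ω

butterfly-above-or-below : ∀ (X : Butterfly n) →
  (∃[ v ] Σ[ eq ∈ Vec.sum v + 3 ≡ n ] X ≈ᵇ aboveButterfly {n} v eq) ⊎
    (∃[ v ] Σ[ eq ∈ Vec.sum v + 3 ≡ n ∸ 2 ] X ≈ᵇ belowButterfly {n} v eq)
butterfly-above-or-below {n} X = [ isAbove , isBelow ]′ (square-above-or-below
  (λ eq → π₁≉π₂ (lengths-injective {π = π₁} {π₂} eq))
  (⋖⇒Step π₁ σ₁ π₁⋖σ₁) (⋖⇒Step π₁ σ₂ π₁⋖σ₂) (⋖⇒Step π₂ σ₁ π₂⋖σ₁) (⋖⇒Step π₂ σ₂ π₂⋖σ₂)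
  (λ eq → σ₁≉σ₂ (lengths-injective {π = σ₁} {σ₂} eq)))
  where
  open Butterfly X
  π₁≉π₂ : ¬ π₁ ≈ᴮ π₂
  π₁≉π₂ with (p ∷ _) ∷ _ ← distinct = p
  σ₁≉σ₂ : ¬ σ₁ ≈ᴮ σ₂
  σ₁≉σ₂ with _ ∷ _ ∷ (p ∷ _) ∷ _ ← distinct = p
  isAbove : ∃[ v ] lengthsList X ↭ above v → (∃[ v ] Σ[ eq ∈ Vec.sum v + 3 ≡ n ] X ≈ᵇ aboveButterfly {n} v eq)
    ⊎ (∃[ v ] Σ[ eq ∈ Vec.sum v + 3 ≡ n ∸ 2 ] X ≈ᵇ belowButterfly {n} v eq)
  isAbove (v , X↭) = inj₁ (v , eq , ↭⇒≈ᵇ X (aboveButterfly {n} v eq)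
    (subst (lengthsList X ↭_) (sym (lengthsList-above v eq)) X↭))
    where
    eq : Vec.sum v + 3 ≡ n
    eq = trans (sym (size-bump 0F v)) (size-∈ X (∈-resp-↭ (↭-sym X↭) (∈-above 0F v)))
  isBelow : ∃[ v ] lengthsList X ↭ below v → (∃[ v ] Σ[ eq ∈ Vec.sum v + 3 ≡ n ] X ≈ᵇ aboveButterfly {n} v eq)
    ⊎ (∃[ v ] Σ[ eq ∈ Vec.sum v + 3 ≡ n ∸ 2 ] X ≈ᵇ belowButterfly {n} v eq)
  isBelow (v , X↭) = inj₂ (v , eq , ↭⇒≈ᵇ X (belowButterfly {n} v eq)
    (subst (lengthsList X ↭_) (sym (lengthsList-below v eq)) X↭))
    where
    eq : Vec.sum v + 3 ≡ n ∸ 2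
    eq = cong (_∸ 2) (trans (sym (size-bumpOthers 0F v)) (size-∈ X (∈-resp-↭ (↭-sym X↭) (∈-below 0F v))))

-- Recovering the base vector of a butterfly.

lookup-ext : ∀ {k} (u v : Vec ℕ k) → (∀ i → lookup u i ≤ lookup v i) → (∀ i → lookup v i ≤ lookup u i) → u ≡ v
lookup-ext []      []      _   _   = refl
lookup-ext (x ∷ u) (y ∷ v) u≤v v≤u = cong₂ _∷_ (≤-antisym (u≤v 0F) (v≤u 0F))
  (lookup-ext u v (u≤v ∘ Fin.suc) (v≤u ∘ Fin.suc))

≤bump : ∀ c v i → lookup v i ≤ lookup (bump c v) i
≤bump c v i with i Fin.≟ c
... | yes refl = ≤-trans (n≤1+n _) (≤-reflexive (sym (lookup∘updateAt i v)))
... | no i≢c   = ≤-reflexive (sym (lookup∘updateAt′ i c i≢c v))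

bump-≢ : ∀ {c i} v → i ≢ c → lookup (bump c v) i ≡ lookup v i
bump-≢ {c} {i} v i≢c = lookup∘updateAt′ i c i≢c v

bumpOthers-≡ : ∀ i v → lookup (bumpOthers i v) i ≡ lookup v i
bumpOthers-≡ i v = trans (lookup∘updateAt i (Vec.map suc v)) (cong pred (lookup-map i suc v))

bumpOthers-≢ : ∀ {c i} v → i ≢ c → lookup (bumpOthers c v) i ≡ suc (lookup v i)
bumpOthers-≢ {c} {i} v i≢c = trans (lookup∘updateAt′ i c i≢c (Vec.map suc v)) (lookup-map i suc v)

bumpOthers-≤ : ∀ c v i → lookup (bumpOthers c v) i ≤ suc (lookup v i)
bumpOthers-≤ c v i with i Fin.≟ c
... | yes refl = ≤-trans (≤-reflexive (bumpOthers-≡ i v)) (n≤1+n _)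
... | no i≢c   = ≤-reflexive (bumpOthers-≢ v i≢c)

-- Two of the vectors v + e_c determine v: their componentwise minimum is v, and
-- dually v + 1 is the componentwise maximum of two of the vectors v + 1 − e_c.
module _ {c d c′ d′ : Fin 4} (c≢d : c ≢ d) {u v : Lengths} where

  private
    differs : ∀ i → i ≢ c ⊎ i ≢ d
    differs i with i Fin.≟ c
    ... | yes refl = inj₂ c≢d
    ... | no i≢c   = inj₁ i≢c

  bump-lookup-≥ : bump c u ≡ bump c′ v → bump d u ≡ bump d′ v → ∀ i → lookup v i ≤ lookup u i
  bump-lookup-≥ eqc eqd i with differs i
  ... | inj₁ i≢c = ≤-trans (≤bump c′ v i)
      (≤-reflexive (trans (cong (λ w → lookup w i) (sym eqc)) (bump-≢ u i≢c)))
  ... | inj₂ i≢d = ≤-trans (≤bump d′ v i)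
      (≤-reflexive (trans (cong (λ w → lookup w i) (sym eqd)) (bump-≢ u i≢d)))

  -- If `c′` and `d′` agreed, so would `bump c u` and `bump d u`, although only the former raises
  -- coordinate `c`. The conclusion permits `bump-lookup-≥` with `u` and `v` exchanged.
  bump-index : bump c u ≡ bump c′ v → bump d u ≡ bump d′ v → c′ ≢ d′
  bump-index eqc eqd refl = contradiction
    (trans (sym (lookup∘updateAt c u)) (trans (cong (λ w → lookup w c) (trans eqc (sym eqd))) (bump-≢ u c≢d)))
    (>⇒≢ (n<1+n _))

  bumpOthers-lookup-≤ : bumpOthers c u ≡ bumpOthers c′ v → bumpOthers d u ≡ bumpOthers d′ v → ∀ i →
    lookup u i ≤ lookup v i
  bumpOthers-lookup-≤ eqc eqd i with differs i
  ... | inj₁ i≢c = s≤s⁻¹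
      (≤-trans (≤-reflexive (trans (sym (bumpOthers-≢ u i≢c)) (cong (λ w → lookup w i) eqc)))
        (bumpOthers-≤ c′ v i))
  ... | inj₂ i≢d = s≤s⁻¹
      (≤-trans (≤-reflexive (trans (sym (bumpOthers-≢ u i≢d)) (cong (λ w → lookup w i) eqd)))
        (bumpOthers-≤ d′ v i))

  bumpOthers-index : bumpOthers c u ≡ bumpOthers c′ v → bumpOthers d u ≡ bumpOthers d′ v → c′ ≢ d′
  bumpOthers-index eqc eqd refl = contradiction
    (trans (sym (bumpOthers-≡ c u)) (trans (cong (λ w → lookup w c) (trans eqc (sym eqd)))
      (bumpOthers-≢ u c≢d)))
    (<⇒≢ (n<1+n _))

module _ {c d c′ d′ : Fin 4} (c≢d : c ≢ d) {u v : Lengths} where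

  bump-determines : bump c u ≡ bump c′ v → bump d u ≡ bump d′ v → u ≡ v
  bump-determines eqc eqd = lookup-ext u v
    (bump-lookup-≥ {c = c′} {d′} {c} {d} (bump-index {d = d} {c′} {d′} c≢d eqc eqd) (sym eqc) (sym eqd))
    (bump-lookup-≥ {c = c} {d} {c′} {d′} c≢d eqc eqd)

  bumpOthers-determines : bumpOthers c u ≡ bumpOthers c′ v → bumpOthers d u ≡ bumpOthers d′ v → u ≡ v
  bumpOthers-determines eqc eqd = lookup-ext u v
    (bumpOthers-lookup-≤ {c = c} {d} {c′} {d′} c≢d eqc eqd)
    (bumpOthers-lookup-≤ {c = c′} {d′} {c} {d} (bumpOthers-index {d = d} {c′} {d′} c≢d eqc eqd) (sym eqc)
      (sym eqd))

sum-mono : ∀ {k} (u v : Vec ℕ k) → (∀ i → lookup u i ≤ lookup v i) → Vec.sum u ≤ Vec.sum v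
sum-mono []      []      _   = z≤n
sum-mono (x ∷ u) (y ∷ v) u≤v = +-mono-≤ (u≤v 0F) (sum-mono u v (u≤v ∘ Fin.suc))

module _ {n : ℕ} {v : Lengths} (|v| : Vec.sum v + 3 ≡ n) (X : Butterfly n) (v≈X : aboveButterfly v |v| ≈ᵇ X)
  where

  above-⊆ : ∀ c → bump c v ∈ lengthsList X
  above-⊆ c = ≈ᵇ⇒⊆ (aboveButterfly v |v|) X v≈X (trans (size-bump c v) |v|)
    (subst (bump c v ∈_) (sym (lengthsList-above v |v|)) (∈-above c v))

module _ {n : ℕ} {v : Lengths} (|v| : Vec.sum v + 3 ≡ n ∸ 2) (X : Butterfly n)
  (v≈X : belowButterfly {n} v |v| ≈ᵇ X) where

  below-⊆ : ∀ c → bumpOthers c v ∈ lengthsList X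
  below-⊆ c = ≈ᵇ⇒⊆ (belowButterfly {n} v |v|) X v≈X (trans (size-bumpOthers c v) (sum+3≡n∸2⇒ v |v|))
    (subst (bumpOthers c v ∈_) (sym (lengthsList-below {n} v |v|)) (∈-below c v))

aboveButterfly-injective : ∀ {u v} (|u| : Vec.sum u + 3 ≡ n) (|v| : Vec.sum v + 3 ≡ n) →
  aboveButterfly u |u| ≈ᵇ aboveButterfly v |v| → u ≡ v
aboveButterfly-injective {u = u} {v} |u| |v| u≈v =
  bump-determines {0F} {1F} (λ ()) (proj₂ (bumped 0F)) (proj₂ (bumped 1F))
  where
  bumped : ∀ c → ∃[ c′ ] bump c u ≡ bump c′ v
  bumped c = above-∈ (subst (bump c u ∈_) (lengthsList-above v |v|)
    (above-⊆ {v = u} |u| (aboveButterfly v |v|) u≈v c))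

belowButterfly-injective : ∀ {u v} (|u| : Vec.sum u + 3 ≡ n ∸ 2) (|v| : Vec.sum v + 3 ≡ n ∸ 2) →
  belowButterfly {n} u |u| ≈ᵇ belowButterfly {n} v |v| → u ≡ v
belowButterfly-injective {n} {u} {v} |u| |v| u≈v =
  bumpOthers-determines {0F} {1F} (λ ()) (proj₂ (bumped 0F)) (proj₂ (bumped 1F))
  where
  bumped : ∀ c → ∃[ c′ ] bumpOthers c u ≡ bumpOthers c′ v
  bumped c = below-∈ (subst (bumpOthers c u ∈_) (lengthsList-below {n} v |v|)
    (below-⊆ {n} {u} |u| (belowButterfly {n} v |v|) u≈v c))

-- Equality would place each u + e_c among the vectors v + 1 - e_c′, so that u ≤ v in every
-- coordinate; but the sum of u exceeds that of v by 2.
above≉below : ∀ {u v} (|u| : Vec.sum u + 3 ≡ n) (|v| : Vec.sum v + 3 ≡ n ∸ 2) →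
  ¬ aboveButterfly u |u| ≈ᵇ belowButterfly {n} v |v|
above≉below {n} {u} {v} |u| |v| u≈v = <⇒≱ (n<1+n _) (≤-trans (n≤1+n _)
  (subst₂ _≤_ (trans |u| (sym (sum+3≡n∸2⇒ v |v|))) refl (+-monoˡ-≤ 3 (sum-mono u v u≤v))))
  where
  bumped : ∀ c → ∃[ c′ ] bump c u ≡ bumpOthers c′ v
  bumped c = below-∈ (subst (bump c u ∈_) (lengthsList-below {n} v |v|)
    (above-⊆ {v = u} |u| (belowButterfly {n} v |v|) u≈v c))
  u≤v : ∀ i → lookup u i ≤ lookup v i
  u≤v i with c , eq ← bumped i = s≤s⁻¹ (≤-trans
    (≤-reflexive (trans (sym (lookup∘updateAt i u)) (cong (λ w → lookup w i) eq))) (bumpOthers-≤ c v i))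

-- Enumeration by compositions

-- Vectors of k + 1 naturals with sum n - k, of which there are C(n, k); with these parameters the
-- recursion is exactly Pascal's rule.
Composition : ℕ → ℕ → Set
Composition k n = Σ[ v ∈ Vec ℕ (suc k) ] Vec.sum v + k ≡ n

Composition-≡ : ∀ {k} {x y : Composition k n} → proj₁ x ≡ proj₁ y → x ≡ y
Composition-≡ {x = v , p} {.v , q} refl = cong (v ,_) (≡-irrelevant p q)

Composition-0 : Fin 1 ↔ Composition 0 n
Composition-0 {n} = mk↔ₛ′ (λ _ → n ∷ [] , trans (+-identityʳ _) (+-identityʳ n)) (λ _ → 0F)
  (λ where (x ∷ [] , eq) → Composition-≡ (cong (_∷ []) (trans (sym eq) (trans (+-identityʳ _) (+-identityʳ x)))))
  (λ { 0F → refl ; (Fin.suc ()) })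

-- A first entry 0 is dropped, a positive one is lowered by one.
Composition-suc : ∀ {k} → (Composition k n ⊎ Composition (suc k) n) ↔ Composition (suc k) (suc n)
Composition-suc {n} {k} = mk↔ₛ′
  (λ where
    (inj₁ (v , eq))     → 0 ∷ v , trans (+-suc _ k) (cong suc eq)
    (inj₂ (x ∷ v , eq)) → suc x ∷ v , cong suc eq)
  (λ where
    (zero ∷ v , eq)  → inj₁ (v , suc-injective (trans (sym (+-suc _ k)) eq))
    (suc x ∷ v , eq) → inj₂ (x ∷ v , suc-injective eq))
  (λ where
    (zero ∷ v , eq)  → Composition-≡ refl
    (suc x ∷ v , eq) → Composition-≡ refl)
  (λ where
    (inj₁ (v , eq))     → cong inj₁ (Composition-≡ refl)
    (inj₂ (x ∷ v , eq)) → cong inj₂ (Composition-≡ refl))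

Composition-zero : ∀ {k} → Fin 0 ↔ Composition (suc k) 0
Composition-zero {k} = mk↔ₛ′ (λ ()) (λ (v , eq) → contradiction (trans (sym (+-suc _ k)) eq) λ ())
  (λ (v , eq) → contradiction (trans (sym (+-suc _ k)) eq) λ ()) (λ ())

Fin↔Composition : ∀ k n → Fin (n C k) ↔ Composition k n
Fin↔Composition zero    n       = subst (λ m → Fin m ↔ Composition 0 n) (sym (nC0≡1 n)) Composition-0
  where
  nC0≡1 : ∀ n → n C 0 ≡ 1
  nC0≡1 n = trans (nCk≡nC[n∸k] {0} {n} z≤n) (nCn≡1 n)
Fin↔Composition (suc k) zero    = subst (λ m → Fin m ↔ Composition (suc k) 0)
  (sym (k>n⇒nCk≡0 {0} {suc k} z<s)) Composition-zero
Fin↔Composition (suc k) (suc n) = subst (λ m → Fin m ↔ Composition (suc k) (suc n))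
  (nCk+nC[k+1]≡[n+1]C[k+1] n k)
  (Composition-suc ↔-∘ ((Fin↔Composition k n ⊎-↔ Fin↔Composition (suc k) n) ↔-∘ +↔⊎))

module _ {S : Setoid 0ℓ 0ℓ} {A : Set} {N : ℕ} (Fin↔A : Fin N ↔ A) where

  open Setoid S using (Carrier; _≈_; reflexive)

  hasCardinality : (f : A → Carrier) → (∀ {x y} → f x ≈ f y → x ≡ y) → (∀ y → ∃[ x ] f x ≈ y) →
    HasCardinality S N
  hasCardinality f inj surj = record
    { to        = f ∘ Inverse.to Fin↔A
    ; cong      = λ eq → reflexive (cong (f ∘ Inverse.to Fin↔A) eq)
    ; bijective = (λ eq → Injection.injective (↔⇒↣ Fin↔A) (inj eq)) , λ y →
        Inverse.from Fin↔A (proj₁ (surj y)) , λ where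
          refl → subst (λ x → f x ≈ y) (sym (Inverse.strictlyInverseˡ Fin↔A _)) (proj₂ (surj y))
    }

module _ (n : ℕ) where

  open Setoid (butterflySetoid n) using () renaming (sym to ≈ᵇ-sym)

  fromComposition : Composition 3 n ⊎ Composition 3 (n ∸ 2) → Butterfly n
  fromComposition (inj₁ (v , |v|)) = aboveButterfly v |v|
  fromComposition (inj₂ (v , |v|)) = belowButterfly {n} v |v|

  fromComposition-injective : ∀ {x y} → fromComposition x ≈ᵇ fromComposition y → x ≡ y
  fromComposition-injective {inj₁ (u , |u|)} {inj₁ (v , |v|)} u≈v =
    cong inj₁ (Composition-≡ (aboveButterfly-injective {n} {u} {v} |u| |v| u≈v))
  fromComposition-injective {inj₁ (u , |u|)} {inj₂ (v , |v|)} u≈v =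
    ⊥-elim (above≉below {n} {u} {v} |u| |v| u≈v)
  fromComposition-injective {inj₂ (u , |u|)} {inj₁ (v , |v|)} u≈v =
    ⊥-elim (above≉below {n} {v} {u} |v| |u| (≈ᵇ-sym {belowButterfly {n} u |u|} {aboveButterfly {n} v |v|}
      u≈v))
  fromComposition-injective {inj₂ (u , |u|)} {inj₂ (v , |v|)} u≈v =
    cong inj₂ (Composition-≡ (belowButterfly-injective {n} {u} {v} |u| |v| u≈v))

  fromComposition-surjective : ∀ X → ∃[ x ] fromComposition x ≈ᵇ X
  fromComposition-surjective X with butterfly-above-or-below X
  ... | inj₁ (v , |v| , X≈v) = inj₁ (v , |v|) , ≈ᵇ-sym {X} {aboveButterfly v |v|} X≈v
  ... | inj₂ (v , |v| , X≈v) = inj₂ (v , |v|) , ≈ᵇ-sym {X} {belowButterfly {n} v |v|} X≈v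

  Fin↔codes : Fin (n C 3 + (n ∸ 2) C 3) ↔ (Composition 3 n ⊎ Composition 3 (n ∸ 2))
  Fin↔codes = (Fin↔Composition 3 n ⊎-↔ Fin↔Composition 3 (n ∸ 2)) ↔-∘ +↔⊎ {n C 3} {(n ∸ 2) C 3}

  butterflies-count : HasCardinality (butterflySetoid n) (n C 3 + (n ∸ 2) C 3)
  butterflies-count = hasCardinality {butterflySetoid n} Fin↔codes
    fromComposition
    (λ {x} {y} → fromComposition-injective {x} {y}) fromComposition-surjective

-- Butterflies containing an edge

Step-bump : ∀ {p s} → Step p s → ∃[ v ] ∃[ c ] ∃[ d ] (c ≢ d × p ≡ bump c v × s ≡ bump d v)
Step-bump (1→2 {a} {m} {k} {d}) = a ∷ m ∷ k ∷ d ∷ [] , 0F , 1F , (λ ()) , refl , refl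
Step-bump (1→3 {a} {m} {k} {d}) = a ∷ m ∷ k ∷ d ∷ [] , 0F , 2F , (λ ()) , refl , refl
Step-bump (4→2 {a} {m} {k} {d}) = a ∷ m ∷ k ∷ d ∷ [] , 3F , 1F , (λ ()) , refl , refl
Step-bump (4→3 {a} {m} {k} {d}) = a ∷ m ∷ k ∷ d ∷ [] , 3F , 2F , (λ ()) , refl , refl

CommonZero : Lengths → Lengths → Set
CommonZero p s = ∃[ i ] (lookup p i ≡ 0 × lookup s i ≡ 0)

-- The two coordinates involved in a step are each positive at one end, so a common zero can only be
-- one of the two untouched coordinates. If those are positive, lowering them by one yields the base
-- vector.
Step-bumpOthers : ∀ {p s} → Step p s → CommonZero p s ⊎
  ∃[ v ] ∃[ c ] ∃[ d ] (c ≢ d × p ≡ bumpOthers c v × s ≡ bumpOthers d v)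
Step-bumpOthers (1→2 {k = zero})            = inj₁ (2F , refl , refl)
Step-bumpOthers (1→2 {k = suc _} {zero})    = inj₁ (3F , refl , refl)
Step-bumpOthers (1→2 {a} {m} {suc k} {suc d}) = inj₂ (a ∷ m ∷ k ∷ d ∷ [] , 1F , 0F , (λ ()) , refl , refl)
Step-bumpOthers (1→3 {m = zero})            = inj₁ (1F , refl , refl)
Step-bumpOthers (1→3 {m = suc _} {d = zero}) = inj₁ (3F , refl , refl)
Step-bumpOthers (1→3 {a} {suc m} {k} {suc d}) = inj₂ (a ∷ m ∷ k ∷ d ∷ [] , 2F , 0F , (λ ()) , refl , refl)
Step-bumpOthers (4→2 {a = zero})            = inj₁ (0F , refl , refl)
Step-bumpOthers (4→2 {a = suc _} {k = zero}) = inj₁ (2F , refl , refl)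
Step-bumpOthers (4→2 {suc a} {m} {suc k} {d}) = inj₂ (a ∷ m ∷ k ∷ d ∷ [] , 1F , 3F , (λ ()) , refl , refl)
Step-bumpOthers (4→3 {a = zero})            = inj₁ (0F , refl , refl)
Step-bumpOthers (4→3 {a = suc _} {m = zero}) = inj₁ (1F , refl , refl)
Step-bumpOthers (4→3 {suc a} {suc m} {k} {d}) = inj₂ (a ∷ m ∷ k ∷ d ∷ [] , 2F , 3F , (λ ()) , refl , refl)

-- Every coordinate differs from `c` or from `d`, hence is a successor at one of the two ends.
bumpOthers⇒¬CommonZero : ∀ {v c d} → c ≢ d → ¬ CommonZero (bumpOthers c v) (bumpOthers d v)
bumpOthers⇒¬CommonZero {v} {c} {d} c≢d (i , p₀ , s₀) with i Fin.≟ c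
... | no i≢c   = contradiction (trans (sym (bumpOthers-≢ v i≢c)) p₀) λ ()
... | yes refl = contradiction (trans (sym (bumpOthers-≢ v c≢d)) s₀) λ ()

Fin1-irrelevant : ∀ (i j : Fin 1) → i ≡ j
Fin1-irrelevant 0F 0F = refl

hasCardinality-1⇒≈ : ∀ {S : Setoid 0ℓ 0ℓ} → HasCardinality S 1 → ∀ x y → Setoid._≈_ S x y
hasCardinality-1⇒≈ {S} card x y with Bijection.surjective card x | Bijection.surjective card y
... | i , x≈ | j , y≈ = Setoid.trans S (Setoid.sym S (x≈ (Fin1-irrelevant j i))) (y≈ refl)

module Edge {n : ℕ} (π σ : Bigrassmannian n) where

  private
    S : Setoid 0ℓ 0ℓ
    S = butterfliesContaining π σ
    open Setoid (butterflySetoid n) using (_≈_) renaming (sym to ≈-sym)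

    butterfly : Setoid.Carrier S → Butterfly n
    butterfly = proj₁

  containsBoth : ∀ (X : Butterfly n) {L} → lengthsList X ≡ L → lengths π ∈ L → lengths σ ∈ L →
    Setoid.Carrier S
  containsBoth X eq π∈ σ∈ = X ,
    ∈⇒∈ᵇ {ω = π} X (subst (lengths π ∈_) (sym eq) π∈) , ∈⇒∈ᵇ {ω = σ} X (subst (lengths σ ∈_) (sym eq) σ∈)

  containsBoth⁻¹ : ∀ (Y : Setoid.Carrier S) (X : Butterfly n) {L} → lengthsList X ≡ L → butterfly Y ≈ X →
    lengths π ∈ L × lengths σ ∈ L
  containsBoth⁻¹ (Y , π∈ , σ∈) X refl (Y⊆X , _) = ∈ᵇ⇒∈ {ω = π} X (Y⊆X {π} π∈) , ∈ᵇ⇒∈ {ω = σ} X (Y⊆X {σ} σ∈)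

  module Above {v c d} (c≢d : c ≢ d) (π≡ : lengths π ≡ bump c v) (σ≡ : lengths σ ≡ bump d v) where

    |v| : Vec.sum v + 3 ≡ n
    |v| = trans (sym (size-bump c v)) (trans (cong size (sym π≡)) (size-lengths π))

    X↑ : Setoid.Carrier S
    X↑ = containsBoth (aboveButterfly {n} v |v|) (lengthsList-above {n} v |v|)
      (subst (_∈ above v) (sym π≡) (∈-above c v)) (subst (_∈ above v) (sym σ≡) (∈-above d v))

    -- The butterfly contains both ends of the edge, and two of its vectors determine its base.
    above-unique : ∀ (Y : Setoid.Carrier S) u |u| → butterfly Y ≈ aboveButterfly {n} u |u| →
      butterfly X↑ ≈ butterfly Y
    above-unique Y u |u| Y≈u with containsBoth⁻¹ Y (aboveButterfly {n} u |u|) (lengthsList-above {n} u |u|)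
      Y≈u
    ... | π∈ , σ∈ with above-∈ π∈ | above-∈ σ∈
    ... | c′ , π≡′ | d′ , σ≡′ with bump-determines {c} {d} {c′} {d′} c≢d {v} {u} (trans (sym π≡) π≡′)
        (trans (sym σ≡) σ≡′)
    ... | refl with ≡-irrelevant |v| |u|
    ... | refl = ≈-sym {butterfly Y} {aboveButterfly {n} u |u|} Y≈u

  module Below {v c d} (c≢d : c ≢ d) (π≡ : lengths π ≡ bumpOthers c v) (σ≡ : lengths σ ≡ bumpOthers d v) where

    |v| : Vec.sum v + 3 ≡ n ∸ 2
    |v| = cong (_∸ 2) (trans (sym (size-bumpOthers c v)) (trans (cong size (sym π≡)) (size-lengths π)))

    X↓ : Setoid.Carrier S
    X↓ = containsBoth (belowButterfly {n} v |v|) (lengthsList-below {n} v |v|)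
      (subst (_∈ below v) (sym π≡) (∈-below c v)) (subst (_∈ below v) (sym σ≡) (∈-below d v))

    below-unique : ∀ (Y : Setoid.Carrier S) u |u| → butterfly Y ≈ belowButterfly {n} u |u| →
      butterfly X↓ ≈ butterfly Y
    below-unique Y u |u| Y≈u with containsBoth⁻¹ Y (belowButterfly {n} u |u|) (lengthsList-below {n} u |u|)
      Y≈u
    ... | π∈ , σ∈ with below-∈ π∈ | below-∈ σ∈
    ... | c′ , π≡′ | d′ , σ≡′ with bumpOthers-determines {c} {d} {c′} {d′} c≢d {v} {u} (trans (sym π≡) π≡′)
        (trans (sym σ≡) σ≡′)
    ... | refl with ≡-irrelevant |v| |u|
    ... | refl = ≈-sym {butterfly Y} {belowButterfly {n} u |u|} Y≈u

  module _ {v c d} (c≢d : c ≢ d) (π≡ : lengths π ≡ bump c v) (σ≡ : lengths σ ≡ bump d v) where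

    open Above c≢d π≡ σ≡

    one : CommonZero (lengths π) (lengths σ) → HasCardinality S 1
    one common = hasCardinality {S} (↔-id (Fin 1)) (λ _ → X↑) (λ {i} {j} _ → Fin1-irrelevant i j)
      λ Y → 0F , unique Y
      where
      unique : ∀ Y → butterfly X↑ ≈ butterfly Y
      unique Y with butterfly-above-or-below (butterfly Y)
      ... | inj₁ (u , |u| , Y≈u) = above-unique Y u |u| Y≈u
      ... | inj₂ (u , |u| , Y≈u) with containsBoth⁻¹ Y (belowButterfly {n} u |u|)
          (lengthsList-below {n} u |u|) Y≈u
      ... | π∈ , σ∈ with below-∈ π∈ | below-∈ σ∈
      ... | c′ , π≡′ | d′ , σ≡′ = ⊥-elim (bumpOthers⇒¬CommonZero {u} {c′} {d′} c′≢d′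
        (subst₂ CommonZero π≡′ σ≡′ common))
        where
        -- Otherwise `π` and `σ` would have the same vector, but only `bump c v` raises coordinate
        -- `c`.
        c′≢d′ : c′ ≢ d′
        c′≢d′ refl = contradiction
          (trans (sym (lookup∘updateAt c v))
            (trans (cong (λ w → lookup w c) (trans (sym π≡) (trans π≡′ (trans (sym σ≡′) σ≡))))
              (bump-≢ v c≢d)))
          (>⇒≢ (n<1+n _))

    module _ {v′ c′ d′} (c′≢d′ : c′ ≢ d′) (π≡′ : lengths π ≡ bumpOthers c′ v′)
      (σ≡′ : lengths σ ≡ bumpOthers d′ v′) where

      open Below c′≢d′ π≡′ σ≡′ renaming (|v| to |v′|)

      X↑≉X↓ : ¬ butterfly X↑ ≈ butterfly X↓
      X↑≉X↓ = above≉below {n} {v} {v′} |v| |v′|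

      two : HasCardinality S 2
      two = hasCardinality {S} (↔-id (Fin 2)) f (λ {x} {y} → inj {x} {y}) surj
        where
        f : Fin 2 → Setoid.Carrier S
        f 0F = X↑
        f 1F = X↓
        inj : ∀ {x y} → butterfly (f x) ≈ butterfly (f y) → x ≡ y
        inj {0F} {0F} _  = refl
        inj {1F} {1F} _  = refl
        inj {0F} {1F} eq = ⊥-elim (X↑≉X↓ eq)
        inj {1F} {0F} eq = ⊥-elim (X↑≉X↓ (≈-sym {butterfly X↓} {butterfly X↑} eq))
        surj : ∀ Y → ∃[ x ] butterfly (f x) ≈ butterfly Y
        surj Y with butterfly-above-or-below (butterfly Y)
        ... | inj₁ (u , |u| , Y≈u) = 0F , above-unique Y u |u| Y≈u
        ... | inj₂ (u , |u| , Y≈u) = 1F , below-unique Y u |u| Y≈u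

  butterfliesOnEdge : Step (lengths π) (lengths σ) →
    (HasCardinality S 1 ⊎ HasCardinality S 2) × (HasCardinality S 1 ⇔ CommonZero (lengths π) (lengths σ))
  butterfliesOnEdge step with Step-bump step | Step-bumpOthers step
  ... | v , c , d , c≢d , π≡ , σ≡ | inj₁ common =
    inj₁ (one c≢d π≡ σ≡ common) , mk⇔ (λ _ → common) (λ _ → one c≢d π≡ σ≡ common)
  ... | v , c , d , c≢d , π≡ , σ≡ | inj₂ (v′ , c′ , d′ , c′≢d′ , π≡′ , σ≡′) =
    inj₂ (two c≢d π≡ σ≡ c′≢d′ π≡′ σ≡′) , mk⇔
      -- A single butterfly would identify `X↑` with `X↓`, which belong to different families.
      (λ card → ⊥-elim (X↑≉X↓ c≢d π≡ σ≡ c′≢d′ π≡′ σ≡′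
        (hasCardinality-1⇒≈ {S} card (Above.X↑ c≢d π≡ σ≡) (Below.X↓ c′≢d′ π≡′ σ≡′))))
      (λ common → ⊥-elim (bumpOthers⇒¬CommonZero {v′} {c′} {d′} c′≢d′ (subst₂ CommonZero π≡′ σ≡′ common)))

commonZero⇔commonLength : ∀ (π σ : Bigrassmannian n) →
  CommonZero (lengths π) (lengths σ) ⇔ (∃[ i ] (HasLength π i 1 × HasLength σ i 1))
commonZero⇔commonLength π σ = mk⇔
  (λ (i , π₀ , σ₀) → i , ⇒hasLength-1 π π₀ , ⇒hasLength-1 σ σ₀)
  (λ (i , π₁ , σ₁) → i , hasLength-1⇒ π π₁ , hasLength-1⇒ σ σ₁)

theorem3p6 : (n : ℕ) → n ≥ 1 →
    HasCardinality (butterflySetoid n) (n C 3 + (n ∸ 2) C 3)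
    × ((π σ : Bigrassmannian n) → π ⋖ σ →
    (HasCardinality (butterfliesContaining π σ) 1
    ⊎ HasCardinality (butterfliesContaining π σ) 2)
    × (HasCardinality (butterfliesContaining π σ) 1
    ⇔ (∃[ i ] (HasLength π i 1 × HasLength σ i 1))))
theorem3p6 n _ = butterflies-count n , λ π σ π⋖σ →
  let count , unique = Edge.butterfliesOnEdge π σ (⋖⇒Step π σ π⋖σ)
  in count , (commonZero⇔commonLength π σ ⇔-∘ unique)
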